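{- Let $(\mathcal{F},\mathcal{G})$ be an LE-signature, $\epsilon$ an order-type and $\Omega$ a strict partial order on the propositional variables. Every $\tau_\epsilon$-transferable analytic $(\Omega,\epsilon)$-inductive $\mathcal{L}_{\mathrm{DLE}}$-inequality $\phi\leq\psi$ is canonical: for every normal distributive lattice expansion $\mathbb{A}$ of this signature, if $\phi\leq\psi$ holds in $\mathbb{A}$ under all assignments, then it holds in the canonical extension $\mathbb{A}^\delta$ under all assignments.
   Context: Signature and terms. An order-type over $n$ is $\epsilon\in\{1,\partial\}^n$; $\epsilon^\partial$ is its opposite. For a lattice $A$, $A^1=A$, $A^\partial$ its order dual, $A^\epsilon=\prod_i A^{\epsilon(i)}$ with product order $\leq^\epsilon$. An LE-signature consists of disjoint sets $\mathcal{F},\mathcal{G}$ of connectives, each $h$ with arity $n_h$ and order-type $\epsilon_h$ over $n_h$. $\mathcal{L}_{\mathrm{DLE}}$-terms: $\phi::=p\mid\bot\mid\top\mid\phi\wedge\phi\mid\phi\vee\phi\mid f(\overline{\phi})\mid g(\overline{\phi})$, $p\in\mathsf{PROP}$. Normal DLEs and canonical extensions. A normal DLE is $\mathbb{A}=(A,\{f^{\mathbb{A}}\},\{g^{\mathbb{A}}\})$ with $A$ a bounded distributive lattice, each $f^{\mathbb{A}}:A^{n_f}\to A$ preserving finite (including empty) joins in each coordinate with $\epsilon_f(i)=1$ and turning finite (including empty) meets into joins in each coordinate with $\epsilon_f(i)=\partial$, and each $g^{\mathbb{A}}$ preserving finite meets in coordinates with $\epsilon_g(i)=1$ and turning finite joins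 into meets in coordinates with $\epsilon_g(i)=\partial$. The canonical extension $A^\delta$ of $A$ is the complete lattice containing $A$ as a dense (every element is a join of meets and a meet of joins of elements of $A$) and compact (if $\bigwedge S\leq\bigvee T$ for $S,T\subseteq A$ then $\bigwedge S'\leq\bigvee T'$ for finite $S'\subseteq S,T'\subseteq T$) sublattice; closed elements $K(A^\delta)$ are meets, open elements $O(A^\delta)$ joins, of subsets of $A$; $K((A^\delta)^\epsilon)$ is the product with $K(A^\delta)$ in coordinates with $\epsilon(i)=1$ and $O(A^\delta)$ in those with $\epsilon(i)=\partial$, and dually for $O((A^\delta)^\epsilon)$. $f^\sigma(\overline{k})=\bigwedge\{f(\overline{a})\mid\overline{a}\in A^{\epsilon_f},\overline{k}\leq^{\epsilon_f}\overline{a}\}$ for $\overline{k}\in K((A^\delta)^{\epsilon_f})$ and $f^\sigma(\overline{u})=\bigvee\{f^\sigma(\overline{k})\mid\overline{k}\in K((A^\delta)^{\epsilon_f}),\overline{k}\leq^{\epsilon_f}\overline{u}\}$; $g^\pi$ is defined order-dually using open elements. $\mathbb{A}^\delta=(A^\delta,\{(f^{\mathbb{A}})^\sigma\},\{(g^{\mathbb{A}})^\pi\})$. Analytic inductive inequalities (with the following node classification). Signed generation trees: the root of the generation tree of $s$ gets sign $+$ (resp. $-$); children of $\vee,\wedge$ get the parent's sign; the $i$-th child of an $h$-node gets the same sign if $\epsilon_h(i)=1$, the opposite if $\epsilon_h(i)=\partial$; for $s\leq t$ consider $+s$ and $-t$. Skeleton nodes: $+\vee,-\wedge,+f\ (f\in\mathcal{F}),-g\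 (g\in\mathcal{G})$. PIA nodes: $+\wedge,-\vee,+g,-f$; SRR nodes are $+g$ with $n_g\geq2$ and $-f$ with $n_f\geq2$. A branch (leaf-to-root path) is good if it consists of a path from the leaf through PIA nodes only, followed by a path to the root through Skeleton nodes only (either possibly empty). A leaf is $\epsilon$-critical if it is $+p$ with $\epsilon(p)=1$ or $-p$ with $\epsilon(p)=\partial$; a signed subtree agrees with $\epsilon^\partial$ if all its variable leaves are $\epsilon^\partial$-critical. $*s$ is $(\Omega,\epsilon)$-inductive if every branch ending in an $\epsilon$-critical leaf $p_i$ is good and, for each SRR node $\circledast(\gamma_1,\ldots,\beta,\ldots,\gamma_m)$ on it ($\beta$ on the branch), each $\gamma_h$ agrees with $\epsilon^\partial$ and all variables $p_k$ in $\gamma_h$ satisfy $p_k<_\Omega p_i$; it is analytic $(\Omega,\epsilon)$-inductive if moreover all its branches are good; $s\leq t$ is analytic $(\Omega,\epsilon)$-inductive if $+s$ and $-t$ are. Transferability. In $+s$ and $-t$ for an analytic $(\Omega,\epsilon)$-inductive $s\leq t$, a maximal PIA-subterm is a signed subtree whose root is not a Skeleton node, whose internal nodes are all PIA nodes, and whose parent (if any) is a Skeleton node. The inequality is $\tau_\epsilon$-transferable if every maximal PIA-subterm containing no $\epsilon$-critical leaf either contains no propositional variables at all, or is a single leaf: a variable $q$ with $\epsilon(q)=\partial$ if its sign is $+$, or a variable $p$ with $\epsilon(p)=1$ if its sign is $-$. -}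

module Defs where

open import Level using (Level; suc; _⊔_) renaming (zero to lzero)
open import Data.Nat using (ℕ) renaming (_≤_ to _≤ℕ_)
open import Data.Fin using (Fin)
open import Data.List using (List; map; foldr)
open import Data.Product using (Σ; _×_; ∃; ∃-syntax; _,_)
open import Data.Sum using (_⊎_)
open import Data.Maybe using (Maybe)
open import Data.Unit using () renaming (⊤ to 𝟙)
open import Data.Empty using () renaming (⊥ to 𝟘)
open import Relation.Nullary using (¬_)
open import Relation.Binary.PropositionalEquality using (_≡_; _≢_)
open import Relation.Binary.Lattice.Bundles using (BoundedLattice)
open import Algebra.Definitions using (_DistributesOverˡ_)
open import Data.Vec.Functional using (updateAt)
open import Function using (const; _∘_)

data Pol : Set where
  one : Pol
  ∂   : Pol

opp : Pol → Pol
opp one = ∂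
opp ∂   = one

record Signature : Set₁ where
  field
    Fc   : Set
    Gc   : Set
    arF  : Fc → ℕ
    arG  : Gc → ℕ
    ordF : (f : Fc) → Fin (arF f) → Pol
    ordG : (g : Gc) → Fin (arG g) → Pol

PROP : Set
PROP = ℕ

module Syntax (Sig : Signature) where
  open Signature Sig

  data Term : Set where
    var    : PROP → Term
    ⊥t ⊤t  : Term
    _∧t_   : Term → Term → Term
    _∨t_   : Term → Term → Term
    fapp   : (f : Fc) → (Fin (arF f) → Term) → Term
    gapp   : (g : Gc) → (Fin (arG g) → Term) → Term

  data Sign : Set where
    ⊕ ⊖ : Sign

  flipS : Sign → Sign
  flipS ⊕ = ⊖
  flipS ⊖ = ⊕

  childSign : Pol → Sign → Sign
  childSign one s = s
  childSign ∂   s = flipS s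

  data Child : Sign → Term → Sign → Term → Set where
    ∧l : ∀ {s a b} → Child s (a ∧t b) s a
    ∧r : ∀ {s a b} → Child s (a ∧t b) s b
    ∨l : ∀ {s a b} → Child s (a ∨t b) s a
    ∨r : ∀ {s a b} → Child s (a ∨t b) s b
    fc : ∀ {s f ts} (i : Fin (arF f)) → Child s (fapp f ts) (childSign (ordF f i) s) (ts i)
    gc : ∀ {s g ts} (i : Fin (arG g)) → Child s (gapp g ts) (childSign (ordG g i) s) (ts i)

  IsLeaf : Term → Set
  IsLeaf (var _)    = 𝟙
  IsLeaf ⊥t         = 𝟙
  IsLeaf ⊤t         = 𝟙
  IsLeaf (_ ∧t _)   = 𝟘
  IsLeaf (_ ∨t _)   = 𝟘
  IsLeaf (fapp f _) = arF f ≡ 0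
  IsLeaf (gapp g _) = arG g ≡ 0

  data Kind : Set where
    skel pia leaf : Kind

  kind : Sign → Term → Kind
  kind _ (var _)    = leaf
  kind _ ⊥t         = leaf
  kind _ ⊤t         = leaf
  kind ⊕ (_ ∧t _)   = pia
  kind ⊖ (_ ∧t _)   = skel
  kind ⊕ (_ ∨t _)   = skel
  kind ⊖ (_ ∨t _)   = pia
  kind ⊕ (fapp _ _) = skel
  kind ⊖ (fapp _ _) = pia
  kind ⊕ (gapp _ _) = pia
  kind ⊖ (gapp _ _) = skel

  data Branch : Sign → Term → Set where
    end  : ∀ {s t} → IsLeaf t → Branch s t
    step : ∀ {s t s' u} → Child s t s' u → Branch s' u → Branch s t

  endSign : ∀ {s t} → Branch s t → Sign
  endSign {s} (end _)  = s
  endSign (step _ b)   = endSign b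

  endTerm : ∀ {s t} → Branch s t → Term
  endTerm {t = t} (end _) = t
  endTerm (step _ b)      = endTerm b

  AllPIA : ∀ {s t} → Branch s t → Set
  AllPIA (end _) = 𝟙
  AllPIA {s} {t} (step _ b) = kind s t ≡ pia × AllPIA b

  Good : ∀ {s t} → Branch s t → Set
  Good (end _) = 𝟙
  Good {s} {t} (step c b) = (kind s t ≡ skel × Good b) ⊎ AllPIA (step c b)

  SRRcond : (Sign → Term → Set) → ∀ {s t s' u} → Child s t s' u → Set
  SRRcond P {s = ⊖} (fc {f = f} {ts} i) =
    2 ≤ℕ arF f → ∀ j → j ≢ i → P (childSign (ordF f j) ⊖) (ts j)
  SRRcond P {s = ⊕} (gc {g = g} {ts} i) =
    2 ≤ℕ arG g → ∀ j → j ≢ i → P (childSign (ordG g j) ⊕) (ts j)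
  SRRcond P _ = 𝟙

  SRRok : (Sign → Term → Set) → ∀ {s t} → Branch s t → Set
  SRRok P (end _)    = 𝟙
  SRRok P (step c b) = SRRcond P c × SRRok P b

  Critical : (PROP → Pol) → Sign → PROP → Set
  Critical ε ⊕ p = ε p ≡ one
  Critical ε ⊖ p = ε p ≡ ∂

  opε : (PROP → Pol) → (PROP → Pol)
  opε ε p = opp (ε p)

  AgreesOpp : (PROP → Pol) → Sign → Term → Set
  AgreesOpp ε s γ = ∀ (b : Branch s γ) q → endTerm b ≡ var q → Critical (opε ε) (endSign b) q

  VarsBelow : (PROP → PROP → Set) → PROP → Sign → Term → Set
  VarsBelow Ω p s γ = ∀ (b : Branch s γ) q → endTerm b ≡ var q → Ω q p

  Inductive : (PROP → PROP → Set) → (PROP → Pol) → Sign → Term → Set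
  Inductive Ω ε s t =
    ∀ (b : Branch s t) p → endTerm b ≡ var p → Critical ε (endSign b) p →
      Good b × SRRok (λ s' γ → AgreesOpp ε s' γ × VarsBelow Ω p s' γ) b

  AnalyticInductiveT : (PROP → PROP → Set) → (PROP → Pol) → Sign → Term → Set
  AnalyticInductiveT Ω ε s t = Inductive Ω ε s t × (∀ (b : Branch s t) → Good b)

  AnalyticInductive : (PROP → PROP → Set) → (PROP → Pol) → Term → Term → Set
  AnalyticInductive Ω ε φ ψ = AnalyticInductiveT Ω ε ⊕ φ × AnalyticInductiveT Ω ε ⊖ ψ

  data MaxPos : Sign → Term → Sign → Term → Set where
    here : ∀ {s t} → kind s t ≢ skel → MaxPos s t s t
    down : ∀ {s t s' u s'' v} → kind s t ≡ skel → Child s t s' u →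
           MaxPos s' u s'' v → MaxPos s t s'' v

  InternalPIA : Sign → Term → Set
  InternalPIA s u = ∀ (b : Branch s u) → AllPIA b

  ContainsCritical : (PROP → Pol) → Sign → Term → Set
  ContainsCritical ε s u = Σ (Branch s u) λ b → Σ PROP λ q → endTerm b ≡ var q × Critical ε (endSign b) q

  NoVars : Sign → Term → Set
  NoVars s u = ∀ (b : Branch s u) q → endTerm b ≢ var q

  SingleOppLeaf : (PROP → Pol) → Sign → Term → Set
  SingleOppLeaf ε s u = Σ PROP λ q → u ≡ var q × Critical (opε ε) s q

  TransferableT : (PROP → Pol) → Sign → Term → Set
  TransferableT ε s t = ∀ s' u → MaxPos s t s' u → InternalPIA s' u →
    ¬ ContainsCritical ε s' u → NoVars s' u ⊎ SingleOppLeaf ε s' u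

  Transferable : (PROP → Pol) → Term → Term → Set
  Transferable ε φ ψ = TransferableT ε ⊕ φ × TransferableT ε ⊖ ψ

module _ {ℓ : Level} where

  record NormalDLE (Sig : Signature) : Set (suc ℓ) where
    open Signature Sig
    field
      lat : BoundedLattice ℓ ℓ ℓ
    open BoundedLattice lat
    field
      distrib : _DistributesOverˡ_ _≈_ _∧_ _∨_
      fA : (f : Fc) → (Fin (arF f) → Carrier) → Carrier
      gA : (g : Gc) → (Fin (arG g) → Carrier) → Carrier
      fA-cong : ∀ f xs ys → (∀ i → xs i ≈ ys i) → fA f xs ≈ fA f ys
      gA-cong : ∀ g xs ys → (∀ i → xs i ≈ ys i) → gA g xs ≈ gA g ys
      f-join-one : ∀ f i xs a b → ordF f i ≡ one →
        fA f (updateAt xs i (const (a ∨ b))) ≈ fA f (updateAt xs i (const a)) ∨ fA f (updateAt xs i (const b))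
      f-bot-one  : ∀ f i xs → ordF f i ≡ one → fA f (updateAt xs i (const ⊥)) ≈ ⊥
      f-join-∂   : ∀ f i xs a b → ordF f i ≡ ∂ →
        fA f (updateAt xs i (const (a ∧ b))) ≈ fA f (updateAt xs i (const a)) ∨ fA f (updateAt xs i (const b))
      f-bot-∂    : ∀ f i xs → ordF f i ≡ ∂ → fA f (updateAt xs i (const ⊤)) ≈ ⊥
      g-meet-one : ∀ g i xs a b → ordG g i ≡ one →
        gA g (updateAt xs i (const (a ∧ b))) ≈ gA g (updateAt xs i (const a)) ∧ gA g (updateAt xs i (const b))
      g-top-one  : ∀ g i xs → ordG g i ≡ one → gA g (updateAt xs i (const ⊤)) ≈ ⊤
      g-meet-∂   : ∀ g i xs a b → ordG g i ≡ ∂ →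
        gA g (updateAt xs i (const (a ∨ b))) ≈ gA g (updateAt xs i (const a)) ∧ gA g (updateAt xs i (const b))
      g-top-∂    : ∀ g i xs → ordG g i ≡ ∂ → gA g (updateAt xs i (const ⊥)) ≈ ⊤

  record CompleteLattice : Set (suc ℓ) where
    field
      blat : BoundedLattice ℓ ℓ ℓ
    open BoundedLattice blat
    field
      ⋁ : {I : Set ℓ} → (I → Carrier) → Carrier
      ⋀ : {I : Set ℓ} → (I → Carrier) → Carrier
      ⋁-upper : ∀ {I} (x : I → Carrier) i → x i ≤ ⋁ x
      ⋁-least : ∀ {I} (x : I → Carrier) z → (∀ i → x i ≤ z) → ⋁ x ≤ z
      ⋀-lower : ∀ {I} (x : I → Carrier) i → ⋀ x ≤ x i
      ⋀-great : ∀ {I} (x : I → Carrier) z → (∀ i → z ≤ x i) → z ≤ ⋀ x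

  record CanonicalExtension (A : BoundedLattice ℓ ℓ ℓ) : Set (suc ℓ) where
    module A = BoundedLattice A
    field
      C : CompleteLattice
    open CompleteLattice C public
    open BoundedLattice blat public
    field
      e     : A.Carrier → Carrier
      e-cong : ∀ a b → a A.≈ b → e a ≈ e b
      e-∧   : ∀ a b → e (a A.∧ b) ≈ (e a ∧ e b)
      e-∨   : ∀ a b → e (a A.∨ b) ≈ (e a ∨ e b)
      e-⊤   : e A.⊤ ≈ ⊤
      e-⊥   : e A.⊥ ≈ ⊥
      e-reflect : ∀ a b → e a ≤ e b → a A.≤ b
      dense-⋁⋀ : ∀ x → Σ (Set ℓ) λ I → Σ (I → Set ℓ) λ J → Σ ((i : I) → J i → A.Carrier) λ a →
                   x ≈ ⋁ (λ i → ⋀ (λ (j : J i) → e (a i j)))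
      dense-⋀⋁ : ∀ x → Σ (Set ℓ) λ I → Σ (I → Set ℓ) λ J → Σ ((i : I) → J i → A.Carrier) λ a →
                   x ≈ ⋀ (λ i → ⋁ (λ (j : J i) → e (a i j)))
      compact : ∀ {I J : Set ℓ} (S : I → A.Carrier) (T : J → A.Carrier) →
                  ⋀ (e ∘ S) ≤ ⋁ (e ∘ T) →
                  Σ (List I) λ xs → Σ (List J) λ ys →
                    foldr A._∧_ A.⊤ (map S xs) A.≤ foldr A._∨_ A.⊥ (map T ys)

    -- closed and open elements
    -- k is a meet of a subset of A; equivalently (and ℓ-small), k is the
    -- meet of the subset {a ∈ A | k ≤ a}
    Closed : Carrier → Set ℓ
    Closed k = k ≈ ⋀ {I = Σ A.Carrier λ a → k ≤ e a} (λ { (a , _) → e a })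

    -- u is a join of a subset of A; equivalently u = ⋁ {a ∈ A | a ≤ u}
    Open : Carrier → Set ℓ
    Open u = u ≈ ⋁ {I = Σ A.Carrier λ a → e a ≤ u} (λ { (a , _) → e a })

    _≤[_]_ : Carrier → Pol → Carrier → Set ℓ
    x ≤[ one ] y = x ≤ y
    x ≤[ ∂ ]   y = y ≤ x

    ClosedAt : Pol → Carrier → Set ℓ
    ClosedAt one = Closed
    ClosedAt ∂   = Open

    OpenAt : Pol → Carrier → Set ℓ
    OpenAt one = Open
    OpenAt ∂   = Closed

    σ-ext : ∀ {n} (ε : Fin n → Pol) → ((Fin n → A.Carrier) → A.Carrier) →
            (Fin n → Carrier) → Carrier
    σ-ext {n} ε h u =
      ⋁ {I = Σ (Fin n → Carrier) λ k → (∀ i → ClosedAt (ε i) (k i)) × (∀ i → k i ≤[ ε i ] u i)}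
        (λ { (k , _) →
          ⋀ {I = Σ (Fin n → A.Carrier) λ a → ∀ i → k i ≤[ ε i ] e (a i)}
            (λ { (a , _) → e (h a) }) })

    π-ext : ∀ {n} (ε : Fin n → Pol) → ((Fin n → A.Carrier) → A.Carrier) →
            (Fin n → Carrier) → Carrier
    π-ext {n} ε h u =
      ⋀ {I = Σ (Fin n → Carrier) λ o → (∀ i → OpenAt (ε i) (o i)) × (∀ i → u i ≤[ ε i ] o i)}
        (λ { (o , _) →
          ⋁ {I = Σ (Fin n → A.Carrier) λ a → ∀ i → e (a i) ≤[ ε i ] o i}
            (λ { (a , _) → e (h a) }) })

  module Interp {Sig : Signature} (𝔸 : NormalDLE Sig) where
    open Signature Sig
    open Syntax Sig
    open NormalDLE 𝔸
    module L = BoundedLattice lat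

    ⟦_⟧ : Term → (PROP → L.Carrier) → L.Carrier
    ⟦ var p ⟧ v    = v p
    ⟦ ⊥t ⟧ v       = L.⊥
    ⟦ ⊤t ⟧ v       = L.⊤
    ⟦ a ∧t b ⟧ v   = ⟦ a ⟧ v L.∧ ⟦ b ⟧ v
    ⟦ a ∨t b ⟧ v   = ⟦ a ⟧ v L.∨ ⟦ b ⟧ v
    ⟦ fapp f ts ⟧ v = fA f (λ i → ⟦ ts i ⟧ v)
    ⟦ gapp g ts ⟧ v = gA g (λ i → ⟦ ts i ⟧ v)

    HoldsIn𝔸 : Term → Term → Set ℓ
    HoldsIn𝔸 φ ψ = ∀ (v : PROP → L.Carrier) → ⟦ φ ⟧ v L.≤ ⟦ ψ ⟧ v

    module _ (D : CanonicalExtension lat) where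
      open CanonicalExtension D

      ⟦_⟧δ : Term → (PROP → Carrier) → Carrier
      ⟦ var p ⟧δ v    = v p
      ⟦ ⊥t ⟧δ v       = ⊥
      ⟦ ⊤t ⟧δ v       = ⊤
      ⟦ a ∧t b ⟧δ v   = ⟦ a ⟧δ v ∧ ⟦ b ⟧δ v
      ⟦ a ∨t b ⟧δ v   = ⟦ a ⟧δ v ∨ ⟦ b ⟧δ v
      ⟦ fapp f ts ⟧δ v = σ-ext (ordF f) (fA f) (λ i → ⟦ ts i ⟧δ v)
      ⟦ gapp g ts ⟧δ v = π-ext (ordG g) (gA g) (λ i → ⟦ ts i ⟧δ v)

      HoldsIn𝔸δ : Term → Term → Set ℓ
      HoldsIn𝔸δ φ ψ = ∀ (v : PROP → Carrier) → ⟦ φ ⟧δ v ≤ ⟦ ψ ⟧δ v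

{-# OPTIONS --safe #-}
-- Skeleton operations preserve joins completely in each coordinate. Hence φ(v) is the join of those
-- closed k for which there are finitely many closed bounds c ≤ u(v) on maximal PIA subterms u such
-- that k ≤ φ(h) for every valuation h in A with c ≤ u(h) for all of them; dually for ψ(v) and open
-- elements. It remains to find one such h for finitely many bounds. Each bound splits into conditions
-- R y a, with a the value at one critical variable p and y the values in the noncritical side terms,
-- all of whose variables lie Ω-below p.
-- Call a ∈ A admissible for p if every condition at p has a solution R y a with y admissible.
-- By compactness and induction along Ω, the admissible elements for p approximate v(p). They are
-- closed under finite meets (in the order of ε), so, descending along Ω, h(p) can be taken to be
-- an admissible element that also improves on the solutions y chosen for the variables above p.
module Submission where

open import Defs
open import Level using (Level) renaming (suc to lsuc)
open import Relation.Binary.PropositionalEquality using (_≡_; _≢_; refl; sym; trans; cong; cong₂; subst)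
open import Relation.Binary.Structures using (IsStrictPartialOrder)
open import Relation.Binary.Lattice.Bundles using (BoundedLattice)
open import Data.Nat using (ℕ; zero; suc; s≤s; z≤n) renaming (_≤_ to _≤ℕ_)
open import Data.Nat.Properties using () renaming (_≟_ to _≟ℕ_)
open import Data.Fin using (Fin; zero; suc)
open import Data.Fin.Properties using () renaming (_≟_ to _≟F_)
open import Data.List using (List; []; _∷_; _++_; map; foldr; concat; tabulate; length; lookup)
open import Data.List.Membership.DecPropositional _≟ℕ_ using (_∈?_)
open import Data.List.Membership.Propositional using (_∈_)
open import Data.List.Membership.Propositional.Properties
  using (∈-concat⁺′; ∈-concat⁻′; ∈-tabulate⁺; ∈-tabulate⁻; ∈-++⁺ˡ; ∈-++⁺ʳ; ∈-++⁻)
open import Data.List.Relation.Unary.Any using (here; there)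
open import Data.List.Relation.Unary.All using ([]; _∷_) renaming (All to AllList; map to mapAll)
open import Data.List.Relation.Unary.All.Properties using (++⁻ˡ; ++⁻ʳ)
open import Data.Product using (Σ; _×_; _,_; proj₁; proj₂)
open import Data.Sum using (_⊎_; inj₁; inj₂)
open import Data.Empty using (⊥; ⊥-elim)
open import Data.Unit using () renaming (⊤ to 𝟙)
open import Data.Vec.Functional using (updateAt) renaming (_∷_ to _∷ᵛ_)
open import Data.Vec.Functional.Properties using (updateAt-updates; updateAt-minimal)
open import Relation.Nullary using (Dec; yes; no)
open import Induction.WellFounded using (Acc; acc; WellFounded; WfRec; module All; module FixPoint)
open import Function using (const; _∘_)

-- Vectors over finite index sets and well-founded restrictions of an order.

-- T is moved from P-vectors to K-vectors one coordinate at a time.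
coordinatewise : ∀ {a b c d} {X : Set a} {n} (T : (Fin n → X) → Set b) →
  (∀ {c c′} → (∀ i → c i ≡ c′ i) → T c → T c′) →
  (P : Fin n → X → Set c) (K : Fin n → X → Set d) →
  (∀ c j → (∀ x → P j x → T (updateAt c j (const x))) →
     ∀ x → K j x → T (updateAt c j (const x))) →
  (∀ c → (∀ i → P i (c i)) → T c) → ∀ c → (∀ i → K i (c i)) → T c
coordinatewise {n = zero} T resp P K sweep base c _ = base c λ ()
coordinatewise {X = X} {n = suc n} T resp P K sweep base c Kc =
  resp split₀ (sweep c zero
    (λ x Px → resp (joined x)
      -- The tail is moved for all heads in `P zero` at once, because `sweep` at the head asks for
      -- the moved tail under every such head.
      (coordinatewise (λ c′ → ∀ x → P zero x → T (x ∷ᵛ c′))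
        (λ eq Tc x Px → resp (cong-∷ eq) (Tc x Px))
        (λ i → P (suc i)) (λ i → K (suc i))
        (λ c′ j IH y Ky x Px → resp (under x c′ j y)
           (sweep (x ∷ᵛ c′) (suc j) (λ z Pz → resp (λ i → sym (under x c′ j z i)) (IH z Pz x Px)) y Ky))
        (λ c′ Pc x Px → base (x ∷ᵛ c′) λ { zero → Px ; (suc i) → Pc i })
        (c ∘ suc) (Kc ∘ suc) x Px))
    (c zero) (Kc zero))
  where
  split₀ : ∀ i → updateAt c zero (const (c zero)) i ≡ c i
  split₀ zero    = refl
  split₀ (suc i) = refl
  joined : ∀ x i → (x ∷ᵛ (c ∘ suc)) i ≡ updateAt c zero (const x) i
  joined x zero    = refl
  joined x (suc i) = refl
  cong-∷ : ∀ {x} {c c′ : Fin n → X} → (∀ i → c i ≡ c′ i) → ∀ i → (x ∷ᵛ c) i ≡ (x ∷ᵛ c′) i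
  cong-∷ eq zero    = refl
  cong-∷ eq (suc i) = eq i
  under : ∀ x c′ j y i → updateAt (x ∷ᵛ c′) (suc j) (const y) i ≡ (x ∷ᵛ updateAt c′ j (const y)) i
  under x c′ j y zero    = refl
  under x c′ j y (suc i) = refl

updateAt-rel : ∀ {a r} {X : Set a} {n} (R : Fin n → X → X → Set r) i {xs ys : Fin n → X} {x y} →
  (∀ j → j ≢ i → R j (xs j) (ys j)) → R i x y →
  ∀ j → R j (updateAt xs i (const x) j) (updateAt ys i (const y) j)
updateAt-rel R zero    rs r zero    = r
updateAt-rel R zero    rs r (suc j) = rs (suc j) λ ()
updateAt-rel R (suc i) rs r zero    = rs zero λ ()
updateAt-rel R (suc i) rs r (suc j) =
  updateAt-rel (R ∘ suc) i (λ j j≢i → rs (suc j) λ { refl → j≢i refl }) r j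

updateAt-all : ∀ {a q} {X : Set a} {n} (Q : Fin n → X → Set q) j {xs : Fin n → X} {x} →
  (∀ i → i ≢ j → Q i (xs i)) → Q j x → ∀ i → Q i (updateAt xs j (const x) i)
updateAt-all Q j {xs} Qxs Qx i with i ≟F j
... | yes refl = subst (Q j) (sym (updateAt-updates j xs)) Qx
... | no  i≢j  = subst (Q i) (sym (updateAt-minimal i j xs i≢j)) (Qxs i i≢j)

all-or-some : ∀ {a b n} {P : Fin n → Set a} {Q : Fin n → Set b} →
  (∀ i → P i ⊎ Q i) → (∀ i → P i) ⊎ Σ (Fin n) Q
all-or-some {n = zero}  dec = inj₁ λ ()
all-or-some {n = suc n} dec with dec zero | all-or-some (dec ∘ suc)
... | inj₂ q | _            = inj₂ (zero , q)
... | inj₁ p | inj₂ (i , q) = inj₂ (suc i , q)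
... | inj₁ p | inj₁ ps      = inj₁ λ { zero → p ; (suc i) → ps i }

all-lookup : ∀ {a p} {X : Set a} {P : X → Set p} xs → (∀ i → P (lookup xs i)) → AllList P xs
all-lookup []       Px = []
all-lookup (x ∷ xs) Px = Px zero ∷ all-lookup xs (Px ∘ suc)

empty : ∀ {a n} {X : Set a} → n ≡ 0 → Fin n → X
empty refl ()

empty-or-inhabited : ∀ n → n ≡ 0 ⊎ Fin n
empty-or-inhabited zero    = inj₁ refl
empty-or-inhabited (suc n) = inj₂ zero

≢⇒2≤ : ∀ {n} (i j : Fin n) → j ≢ i → 2 ≤ℕ n
≢⇒2≤ {suc zero}    zero zero j≢i = ⊥-elim (j≢i refl)
≢⇒2≤ {suc (suc n)} i    j    j≢i = s≤s (s≤s z≤n)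

-- A strict order need not be decidable for its restriction to finitely many points to be well founded.
finite-wellFounded : ∀ {a} {X : Set a} {Ω : X → X → Set} →
  (∀ {x y z} → Ω x y → Ω y z → Ω x z) → (∀ {x} → Ω x x → ⊥) →
  (L : List X) → WellFounded (λ x y → x ∈ L × Ω x y)
finite-wellFounded tr ir [] x = acc λ ()
finite-wellFounded {X = X} {Ω} tr ir (a ∷ L) x = above (finite-wellFounded tr ir L x)
  where
  _⊏_ : (l : List X) → X → X → Set _
  _⊏_ l x y = x ∈ l × Ω x y
  below : ∀ {x} → x ≡ a ⊎ Ω x a → Acc (_⊏_ L) x → Acc (_⊏_ (a ∷ L)) x
  below x≤a (acc rs) = acc λ
    { (here refl , a<x) → ⊥-elim (ir (absurd x≤a a<x))
    ; (there y∈ , y<x) → below (inj₂ (into x≤a y<x)) (rs (y∈ , y<x)) }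
    where
    into : ∀ {x y} → x ≡ a ⊎ Ω x a → Ω y x → Ω y a
    into (inj₁ refl) y<x = y<x
    into (inj₂ x<a) y<x = tr y<x x<a
    absurd : ∀ {x} → x ≡ a ⊎ Ω x a → Ω a x → Ω a a
    absurd = into
  above : ∀ {x} → Acc (_⊏_ L) x → Acc (_⊏_ (a ∷ L)) x
  above (acc rs) = acc λ
    { (here refl , _) → below (inj₁ refl) (finite-wellFounded tr ir L a)
    ; (there y∈ , y<x) → above (rs (y∈ , y<x)) }

-- A lattice order and its dual, indexed by signs.

module SignedOrder (Sig : Signature) {ℓ : Level} (B : BoundedLattice ℓ ℓ ℓ) where
  open Syntax Sig using (Sign; ⊕; ⊖; flipS)
  module B = BoundedLattice B
  open B using (Carrier; _≤_; _∧_; _∨_)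

  -- le ⊖ is the dual order; mt, jn, tp and bt are the lattice operations of le.
  le : Sign → Carrier → Carrier → Set ℓ
  le ⊕ x y = x ≤ y
  le ⊖ x y = y ≤ x

  mt jn : Sign → Carrier → Carrier → Carrier
  mt ⊕ = _∧_
  mt ⊖ = _∨_
  jn s = mt (flipS s)

  tp bt : Sign → Carrier
  tp ⊕ = B.⊤
  tp ⊖ = B.⊥
  bt s = tp (flipS s)

  le-refl : ∀ s {x} → le s x x
  le-refl ⊕ = B.refl
  le-refl ⊖ = B.refl

  le-reflexive : ∀ s {x y} → x ≡ y → le s x y
  le-reflexive s refl = le-refl s

  le-trans : ∀ s {x y z} → le s x y → le s y z → le s x z
  le-trans ⊕ p q = B.trans p q
  le-trans ⊖ p q = B.trans q p

  flip-in : ∀ s {x y} → le s x y → le (flipS s) y x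
  flip-in ⊕ p = p
  flip-in ⊖ p = p

  flip-out : ∀ s {x y} → le (flipS s) x y → le s y x
  flip-out ⊕ p = p
  flip-out ⊖ p = p

  mt-lowerˡ : ∀ s x y → le s (mt s x y) x
  mt-lowerˡ ⊕ x y = B.x∧y≤x x y
  mt-lowerˡ ⊖ x y = B.x≤x∨y x y

  mt-lowerʳ : ∀ s x y → le s (mt s x y) y
  mt-lowerʳ ⊕ x y = B.x∧y≤y x y
  mt-lowerʳ ⊖ x y = B.y≤x∨y x y

  mt-greatest : ∀ s {x y z} → le s z x → le s z y → le s z (mt s x y)
  mt-greatest ⊕ p q = B.∧-greatest p q
  mt-greatest ⊖ p q = B.∨-least p q

  tp-maximum : ∀ s x → le s x (tp s)
  tp-maximum ⊕ x = B.maximum x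
  tp-maximum ⊖ x = B.minimum x

  jn-upperˡ : ∀ s x y → le s x (jn s x y)
  jn-upperˡ s x y = flip-out s (mt-lowerˡ (flipS s) x y)

  jn-upperʳ : ∀ s x y → le s y (jn s x y)
  jn-upperʳ s x y = flip-out s (mt-lowerʳ (flipS s) x y)

  jn-least : ∀ s {x y z} → le s x z → le s y z → le s (jn s x y) z
  jn-least s p q = flip-out s (mt-greatest (flipS s) (flip-in s p) (flip-in s q))

  bt-minimum : ∀ s x → le s (bt s) x
  bt-minimum s x = flip-out s (tp-maximum (flipS s) x)

  ⨅ : ∀ s {n} → (Fin n → Carrier) → Carrier
  ⨅ s {zero}  x = tp s
  ⨅ s {suc n} x = mt s (x zero) (⨅ s (x ∘ suc))

  ⨅-lower : ∀ s {n} (x : Fin n → Carrier) i → le s (⨅ s x) (x i)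
  ⨅-lower s x zero    = mt-lowerˡ s _ _
  ⨅-lower s x (suc i) = le-trans s (mt-lowerʳ s _ _) (⨅-lower s (x ∘ suc) i)

  ⨅-closed : ∀ s {p n} (P : Carrier → Set p) → P (tp s) → (∀ {x y} → P x → P y → P (mt s x y)) →
    (x : Fin n → Carrier) → (∀ i → P (x i)) → P (⨅ s x)
  ⨅-closed s {n = zero}  P Pt Pm x Px = Pt
  ⨅-closed s {n = suc n} P Pt Pm x Px = Pm (Px zero) (⨅-closed s P Pt Pm (x ∘ suc) (Px ∘ suc))

module Canonicity {ℓ : Level} (Sig : Signature) (𝔸 : NormalDLE {ℓ} Sig)
                  (D : CanonicalExtension (NormalDLE.lat 𝔸)) where
  open Signature Sig
  open Syntax Sig
  open NormalDLE 𝔸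
  open Interp 𝔸 using (⟦_⟧)
  module A = BoundedLattice lat
  module D = CanonicalExtension D
  open D using (e; ⋁; ⋀; Closed; Open)
  open SignedOrder Sig lat renaming (le to leA)
  open SignedOrder Sig D.blat using () renaming
    ( le to leδ; mt to mtδ; le-trans to transδ; flip-in to flip-inδ; flip-out to flip-outδ
    ; mt-lowerˡ to mtδ-lowerˡ; mt-lowerʳ to mtδ-lowerʳ )

  ⟦_⟧δ : Term → (PROP → D.Carrier) → D.Carrier
  ⟦_⟧δ = Interp.⟦_⟧δ 𝔸 D

  Val : Set ℓ
  Val = PROP → A.Carrier

  -- Density and compactness of the canonical extension.

  e-mono : ∀ s {a b} → leA s a b → leδ s (e a) (e b)
  e-mono ⊕ {a} {b} a≤b =
    D.trans (D.reflexive (D.e-cong _ _ (A.antisym (A.∧-greatest A.refl a≤b) (A.x∧y≤x a b))))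
            (D.trans (D.reflexive (D.e-∧ a b)) (D.x∧y≤y _ _))
  e-mono ⊖ b≤a = e-mono ⊕ b≤a

  e-mt : ∀ s {k a b} → leδ s k (e a) → leδ s k (e b) → leδ s k (e (mt s a b))
  e-mt ⊕ {k} p q = D.trans (D.∧-greatest p q) (D.reflexive (D.Eq.sym (D.e-∧ _ _)))
  e-mt ⊖ {k} p q = D.trans (D.reflexive (D.e-∨ _ _)) (D.∨-least p q)

  e-tp : ∀ s k → leδ s k (e (tp s))
  e-tp ⊕ k = D.trans (D.maximum k) (D.reflexive (D.Eq.sym D.e-⊤))
  e-tp ⊖ k = D.trans (D.reflexive D.e-⊥) (D.minimum k)

  e-jn : ∀ s {k a b} → leδ s (e a) k → leδ s (e b) k → leδ s (e (jn s a b)) k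
  e-jn s p q = flip-outδ s (e-mt (flipS s) (flip-inδ s p) (flip-inδ s q))

  e-bt : ∀ s k → leδ s (e (bt s)) k
  e-bt s k = flip-outδ s (e-tp (flipS s) k)

  -- Dualising the order exchanges closed and open elements, so `closed (flipS s)` holds of the
  -- elements that are open with respect to `leδ s`.
  closed : Sign → D.Carrier → Set ℓ
  closed ⊕ = Closed
  closed ⊖ = Open

  sup inf : Sign → {I : Set ℓ} → (I → D.Carrier) → D.Carrier
  sup ⊕ = ⋁
  sup ⊖ = ⋀
  inf s = sup (flipS s)

  sup-upper : ∀ s {I : Set ℓ} (x : I → D.Carrier) i → leδ s (x i) (sup s x)
  sup-upper ⊕ = D.⋁-upper
  sup-upper ⊖ = D.⋀-lower

  sup-least : ∀ s {I : Set ℓ} (x : I → D.Carrier) z → (∀ i → leδ s (x i) z) → leδ s (sup s x) z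
  sup-least ⊕ = D.⋁-least
  sup-least ⊖ = D.⋀-great

  inf-lower : ∀ s {I : Set ℓ} (x : I → D.Carrier) i → leδ s (inf s x) (x i)
  inf-lower s x i = flip-outδ s (sup-upper (flipS s) x i)

  inf-greatest : ∀ s {I : Set ℓ} (x : I → D.Carrier) z → (∀ i → leδ s z (x i)) → leδ s z (inf s x)
  inf-greatest s x z p = flip-outδ s (sup-least (flipS s) x z λ i → flip-inδ s (p i))

  inf-closed : ∀ s {I : Set ℓ} (a : I → A.Carrier) → closed s (inf s (e ∘ a))
  inf-closed ⊕ a = D.antisym (D.⋀-great _ _ λ { (_ , p) → p })
                             (D.⋀-great _ _ λ i → D.⋀-lower _ (a i , D.⋀-lower _ i))
  inf-closed ⊖ a = D.antisym (D.⋁-least _ _ λ i → D.⋁-upper _ (a i , D.⋁-upper _ i))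
                             (D.⋁-least _ _ λ { (_ , p) → p })

  e-closed : ∀ s a → closed s (e a)
  e-closed ⊕ a = D.antisym (D.⋀-great _ _ λ { (_ , p) → p }) (D.⋀-lower _ (a , D.refl))
  e-closed ⊖ a = D.antisym (D.⋁-upper _ (a , D.refl)) (D.⋁-least _ _ λ { (_ , p) → p })

  -- Density writes `x` as a signed join of closed elements, each of them below `x`.
  dense : ∀ s {x z} → (∀ k → closed s k → leδ s k x → leδ s k z) → leδ s x z
  dense ⊕ {x} {z} below with D.dense-⋁⋀ x
  ... | I , J , a , eq = D.trans (D.reflexive eq) (D.⋁-least _ _ λ i →
          below _ (inf-closed ⊕ (a i)) (D.trans (D.⋁-upper _ i) (D.reflexive (D.Eq.sym eq))))
  dense ⊖ {x} {z} below with D.dense-⋀⋁ x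
  ... | I , J , a , eq = D.trans (D.⋀-great _ _ λ i →
          below _ (inf-closed ⊖ (a i)) (D.trans (D.reflexive eq) (D.⋀-lower _ i))) (D.reflexive (D.Eq.sym eq))

  foldr-closed : ∀ {X : Set ℓ} (f : A.Carrier → A.Carrier → A.Carrier) (P : A.Carrier → Set ℓ) {z} (g : X → A.Carrier) →
    P z → (∀ {x y} → P x → P y → P (f x y)) → (∀ x → P (g x)) → ∀ xs → P (foldr f z (map g xs))
  foldr-closed f P g Pz Pf Pg [] = Pz
  foldr-closed f P g Pz Pf Pg (x ∷ xs) = Pf (Pg x) (foldr-closed f P g Pz Pf Pg xs)

  -- Compactness yields finitely many members of `P`, and closure under bottom and binary joins
  -- merges them into one. The closed `k` enters as the meet of the elements of `A` above it.
  compact-directed : ∀ s {k} → closed s k → (P : A.Carrier → Set ℓ) → P (bt s) →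
    (∀ {a b} → P a → P b → P (jn s a b)) →
    leδ s k (sup s {I = Σ A.Carrier P} (e ∘ proj₁)) → Σ A.Carrier λ a → P a × leδ s k (e a)
  compact-directed ⊕ {k} kc P Pb Pj k≤ =
    let xs , ys , h = D.compact {I = Σ A.Carrier λ a → k D.≤ e a} proj₁ proj₁
                        (D.trans (D.reflexive (D.Eq.sym kc)) k≤)
    in _ , foldr-closed A._∨_ P proj₁ Pb Pj proj₂ ys ,
       D.trans (foldr-closed A._∧_ (λ a → k D.≤ e a) proj₁ (e-tp ⊕ k) (e-mt ⊕) proj₂ xs) (e-mono ⊕ h)
  compact-directed ⊖ {k} kc P Pb Pj k≤ =
    let ys , xs , h = D.compact {J = Σ A.Carrier λ a → e a D.≤ k} proj₁ proj₁
                        (D.trans k≤ (D.reflexive kc))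
    in _ , foldr-closed A._∧_ P proj₁ Pb Pj proj₂ ys ,
       D.trans (e-mono ⊕ h) (foldr-closed A._∨_ (λ a → e a D.≤ k) proj₁ (e-tp ⊖ k) (e-mt ⊖) proj₂ xs)

  -- An open `o` is the join of the elements of `A` below it, and these form a family to which
  -- `compact-directed` applies.
  interpolate : ∀ s {k o} → closed s k → closed (flipS s) o → leδ s k o →
    Σ A.Carrier λ a → leδ s k (e a) × leδ s (e a) o
  interpolate s {k} {o} kc oc k≤o =
    let a , a≤o , k≤a = compact-directed s kc (λ a → leδ s (e a) o) (e-bt s o) (e-jn s)
                          (transδ s k≤o (o≤sup s oc))
    in a , k≤a , a≤o
    where
    o≤sup : ∀ s → closed (flipS s) o → leδ s o (sup s {I = Σ A.Carrier λ a → leδ s (e a) o} (e ∘ proj₁))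
    o≤sup ⊕ oc = D.reflexive oc
    o≤sup ⊖ oc = D.reflexive (D.Eq.sym oc)

  -- The connectives and their extensions, seen through signs.

  -- The PIA connectives at sign s; the skeleton connectives at s are those of POp (flipS s).
  POp : Sign → Set
  POp ⊕ = Gc
  POp ⊖ = Fc

  ar : ∀ s → POp s → ℕ
  ar ⊕ = arG
  ar ⊖ = arF

  ord : ∀ s (o : POp s) → Fin (ar s o) → Pol
  ord ⊕ = ordG
  ord ⊖ = ordF

  op : ∀ s (o : POp s) → (Fin (ar s o) → A.Carrier) → A.Carrier
  op ⊕ = gA
  op ⊖ = fA

  opδ : ∀ s (o : POp s) → (Fin (ar s o) → D.Carrier) → D.Carrier
  opδ ⊕ g = D.π-ext (ordG g) (gA g)
  opδ ⊖ f = D.σ-ext (ordF f) (fA f)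

  op-cong : ∀ s o {xs ys} → (∀ i → xs i A.≈ ys i) → op s o xs A.≈ op s o ys
  op-cong ⊕ g = gA-cong g _ _
  op-cong ⊖ f = fA-cong f _ _

  -- The signs unite the four binary preservation laws of a normal expansion. At `flipS s` the same
  -- law expresses join preservation by the skeleton connectives of sign `s`.
  op-mt : ∀ s o i xs a b →
    op s o (updateAt xs i (const (mt (childSign (ord s o i) s) a b))) A.≈
    mt s (op s o (updateAt xs i (const a))) (op s o (updateAt xs i (const b)))
  op-mt ⊕ g i xs a b with ordG g i in eq
  ... | one = g-meet-one g i xs a b eq
  ... | ∂   = g-meet-∂ g i xs a b eq
  op-mt ⊖ f i xs a b with ordF f i in eq
  ... | one = f-join-one f i xs a b eq
  ... | ∂   = f-join-∂ f i xs a b eq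

  op-tp : ∀ s o i xs → op s o (updateAt xs i (const (tp (childSign (ord s o i) s)))) A.≈ tp s
  op-tp ⊕ g i xs with ordG g i in eq
  ... | one = g-top-one g i xs eq
  ... | ∂   = g-top-∂ g i xs eq
  op-tp ⊖ f i xs with ordF f i in eq
  ... | one = f-bot-one f i xs eq
  ... | ∂   = f-bot-∂ f i xs eq

  ≈⇒le : ∀ s {a b} → a A.≈ b → leA s a b
  ≈⇒le ⊕ eq = A.reflexive eq
  ≈⇒le ⊖ eq = A.reflexive (A.Eq.sym eq)

  le-antisym : ∀ s {a b} → leA s a b → leA s b a → a A.≈ b
  le-antisym ⊕ p q = A.antisym p q
  le-antisym ⊖ p q = A.antisym q p

  -- The entries are raised one at a time from `xs` to `ys`; in a single coordinate, monotonicity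
  -- follows from preservation of binary meets.
  op-mono : ∀ s o {xs ys} → (∀ i → leA (childSign (ord s o i) s) (xs i) (ys i)) →
    leA s (op s o xs) (op s o ys)
  op-mono s o {xs} {ys} xs≤ys =
    coordinatewise (λ c → leA s (op s o xs) (op s o c))
      (λ eq p → le-trans s p (≈⇒le s (op-cong s o λ i → A.Eq.reflexive (eq i))))
      (λ i x → xs i ≡ x) (λ i → leA (sgn i) (xs i))
      (λ c j ih y xj≤y → le-trans s (ih (xs j) refl) (mono₁ c j xj≤y))
      (λ c eq → ≈⇒le s (op-cong s o λ i → A.Eq.reflexive (eq i)))
      ys xs≤ys
    where
    sgn : ∀ i → Sign
    sgn i = childSign (ord s o i) s
    mono₁ : ∀ c j {a b} → leA (sgn j) a b →
      leA s (op s o (updateAt c j (const a))) (op s o (updateAt c j (const b)))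
    mono₁ c j {a} {b} a≤b =
      le-trans s (≈⇒le s (A.Eq.trans
        (op-cong s o (updateAt-rel (λ _ → A._≈_) j (λ _ _ → A.Eq.refl)
          (le-antisym (sgn j) (mt-greatest (sgn j) (le-refl (sgn j)) a≤b) (mt-lowerˡ (sgn j) a b))))
        (op-mt s o j c a b)))
      (mt-lowerʳ s _ _)

  -- The extensions are defined by orders indexed by polarities. Relative to sign `⊖` such an order
  -- is the converse of the signed one.
  ≤[]⇒le⊕ : ∀ π {x y} → x D.≤[ π ] y → leδ (childSign π ⊕) x y
  ≤[]⇒le⊕ one p = p
  ≤[]⇒le⊕ ∂   p = p

  le⊕⇒≤[] : ∀ π {x y} → leδ (childSign π ⊕) x y → x D.≤[ π ] y
  le⊕⇒≤[] one p = p
  le⊕⇒≤[] ∂   p = p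

  ≤[]⇒le⊖ : ∀ π {x y} → x D.≤[ π ] y → leδ (childSign π ⊖) y x
  ≤[]⇒le⊖ one p = p
  ≤[]⇒le⊖ ∂   p = p

  le⊖⇒≤[] : ∀ π {x y} → leδ (childSign π ⊖) y x → x D.≤[ π ] y
  le⊖⇒≤[] one p = p
  le⊖⇒≤[] ∂   p = p

  closed⇒OpenAt : ∀ π {x} → closed (flipS (childSign π ⊕)) x → D.OpenAt π x
  closed⇒OpenAt one c = c
  closed⇒OpenAt ∂   c = c

  closed⇒ClosedAt : ∀ π {x} → closed (flipS (childSign π ⊖)) x → D.ClosedAt π x
  closed⇒ClosedAt one c = c
  closed⇒ClosedAt ∂   c = c

  ClosedAt⇒closed : ∀ π {x} → D.ClosedAt π x → closed (childSign π ⊕) x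
  ClosedAt⇒closed one c = c
  ClosedAt⇒closed ∂   c = c

  OpenAt⇒closed : ∀ π {x} → D.OpenAt π x → closed (childSign π ⊖) x
  OpenAt⇒closed one c = c
  OpenAt⇒closed ∂   c = c

  -- In the order of sign `s` both kinds of extension are infima over open vectors above `u`, and
  -- `x` is one of these vectors.
  opδ-open-≤ : ∀ s o {u x : Fin (ar s o) → D.Carrier} → (∀ i → closed (flipS (childSign (ord s o i) s)) (x i)) →
    (∀ i → leδ (childSign (ord s o i) s) (u i) (x i)) →
    leδ s (opδ s o u)
      (sup s {I = Σ (Fin (ar s o) → A.Carrier) λ a → ∀ i → leδ (childSign (ord s o i) s) (e (a i)) (x i)}
             (e ∘ op s o ∘ proj₁))
  opδ-open-≤ ⊕ g {x = x} xo u≤x =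
    D.trans (D.⋀-lower _ (x , (λ i → closed⇒OpenAt (ordG g i) {x i} (xo i)) , (λ i → le⊕⇒≤[] (ordG g i) {y = x i} (u≤x i))))
            (D.⋁-least _ _ λ { (a , p) → D.⋁-upper _ (a , λ i → ≤[]⇒le⊕ (ordG g i) {y = x i} (p i)) })
  opδ-open-≤ ⊖ f {x = x} xo u≤x =
    D.trans (D.⋀-great _ _ λ { (a , p) → D.⋀-lower _ (a , λ i → ≤[]⇒le⊖ (ordF f i) {x i} (p i)) })
            (D.⋁-upper _ (x , (λ i → closed⇒ClosedAt (ordF f i) {x i} (xo i)) , (λ i → le⊖⇒≤[] (ordF f i) {x i} (u≤x i))))

  -- In the opposite order the same extension is a supremum over closed vectors below `u`, so it
  -- suffices to bound each of its terms.
  opδ-closed-least : ∀ s (o : POp (flipS s)) {u : Fin (ar (flipS s) o) → D.Carrier} {z} → let sgn = λ i → childSign (ord (flipS s) o i) s in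
    (∀ (k : Fin (ar (flipS s) o) → D.Carrier) → (∀ i → closed (sgn i) (k i)) → (∀ i → leδ (sgn i) (k i) (u i)) →
      leδ s (inf s {I = Σ (Fin (ar (flipS s) o) → A.Carrier) λ a → ∀ i → leδ (sgn i) (k i) (e (a i))}
                   (e ∘ op (flipS s) o ∘ proj₁)) z) →
    leδ s (opδ (flipS s) o u) z
  opδ-closed-least ⊕ f {z = z} h = D.⋁-least _ _ λ { (k , kc , k≤u) →
    D.trans (D.⋀-great _ _ λ { (a , p) → D.⋀-lower _ (a , λ i → le⊕⇒≤[] (ordF f i) {k i} (p i)) })
            (h k (λ i → ClosedAt⇒closed (ordF f i) {k i} (kc i)) (λ i → ≤[]⇒le⊕ (ordF f i) {k i} (k≤u i))) }
  opδ-closed-least ⊖ g {z = z} h = D.⋀-great _ _ λ { (k , kc , k≤u) →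
    D.trans (h k (λ i → OpenAt⇒closed (ordG g i) {k i} (kc i)) (λ i → ≤[]⇒le⊖ (ordG g i) {y = k i} (k≤u i)))
            (D.⋁-least _ _ λ { (a , p) → D.⋁-upper _ (a , λ i → le⊖⇒≤[] (ordG g i) {y = k i} (p i)) }) }

  -- Approximation of PIA connectives by directed families.

  -- Compactness is built in: a closed element below `x` lies below a single member of the family.
  -- The members themselves may exceed `x`.
  record Approximates (s : Sign) (x : D.Carrier) {X : Set ℓ} (w : X → A.Carrier) : Set ℓ where
    field
      base   : X
      bound  : ∀ x y → Σ X λ z → leA s (w x) (w z) × leA s (w y) (w z)
      approx : ∀ k → closed s k → leδ s k x → Σ X λ i → leδ s k (e (w i))

  record Directed {n} (sgn : Fin n → Sign) {X : Set ℓ} (w : X → Fin n → A.Carrier) : Set ℓ where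
    field
      base  : X
      bound : ∀ x y → Σ X λ z → ∀ i → leA (sgn i) (w x i) (w z i) × leA (sgn i) (w y i) (w z i)

    finite-bound : ∀ {m} (x : Fin m → X) → Σ X λ z → ∀ j i → leA (sgn i) (w (x j) i) (w z i)
    finite-bound {zero}  x = base , λ ()
    finite-bound {suc m} x =
      let z , p = finite-bound (x ∘ suc)
          z′ , q = bound (x zero) z
      in z′ , λ { zero i → proj₁ (q i) ; (suc j) i → le-trans (sgn i) (p j i) (proj₂ (q i)) }

  sup-open : ∀ s {I : Set ℓ} (a : I → A.Carrier) → closed (flipS s) (sup s (e ∘ a))
  sup-open ⊕ = inf-closed ⊖
  sup-open ⊖ = inf-closed ⊕

  e-reflect : ∀ s {a b} → leδ s (e a) (e b) → leA s a b
  e-reflect ⊕ = D.e-reflect _ _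
  e-reflect ⊖ = D.e-reflect _ _

  -- The coordinatewise joins `out` of the family are open and, by density, dominate `u`. The
  -- extension therefore lies below the join of the values at vectors of `A` under `out`.
  -- Compactness puts each entry of such a vector under a member of the family, and directedness
  -- gives one index for all entries.
  op-approximates : ∀ s o {u : Fin (ar s o) → D.Carrier} {X : Set ℓ} (w : X → Fin (ar s o) → A.Carrier) →
    let sgn = λ i → childSign (ord s o i) s in
    Directed sgn w →
    (∀ i k → closed (sgn i) k → leδ (sgn i) k (u i) → Σ X λ x → leδ (sgn i) k (e (w x i))) →
    Approximates s (opδ s o u) (op s o ∘ w)
  op-approximates s o {u} {X} w dir app = record
    { base = base
    ; bound = λ x y → let z , p = bound x y in z , op-mono s o (proj₁ ∘ p) , op-mono s o (proj₂ ∘ p)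
    ; approx = approximate
    }
    where
    open Directed dir
    sgn : Fin (ar s o) → Sign
    sgn i = childSign (ord s o i) s
    out : Fin (ar s o) → D.Carrier
    out i = sup (sgn i) λ x → e (w x i)
    Below : A.Carrier → Set ℓ
    Below b = Σ X λ x → leA s b (op s o (w x))
    Belowᵢ : Fin (ar s o) → A.Carrier → Set ℓ
    Belowᵢ i b = Σ X λ x → leA (sgn i) b (w x i)

    below : (a : Fin (ar s o) → A.Carrier) → (∀ i → leδ (sgn i) (e (a i)) (out i)) → Below (op s o a)
    below a a≤out =
      let z , p = finite-bound (proj₁ ∘ index)
      in z , op-mono s o λ i → le-trans (sgn i) (proj₂ (index i)) (p i i)
      where
      index : ∀ i → Belowᵢ i (a i)
      index i =
        let b , (x , b≤w) , a≤b = compact-directed (sgn i) (e-closed (sgn i) (a i)) (Belowᵢ i)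
              (base , bt-minimum (sgn i) _)
              (λ { (x , p) (y , q) → let z , r = bound x y in
                   z , jn-least (sgn i) (le-trans (sgn i) p (proj₁ (r i))) (le-trans (sgn i) q (proj₂ (r i))) })
              (transδ (sgn i) (a≤out i) (sup-least (sgn i) _ _ λ x →
                sup-upper (sgn i) (e ∘ proj₁) (w x i , x , le-refl (sgn i))))
        in x , le-trans (sgn i) (e-reflect (sgn i) a≤b) b≤w

    approximate : ∀ k → closed s k → leδ s k (opδ s o u) → Σ X λ x → leδ s k (e (op s o (w x)))
    approximate k kc k≤ =
      let b , (x , b≤) , k≤b = compact-directed s kc Below
            (base , bt-minimum s _)
            (λ { (x , p) (y , q) → let z , r = bound x y in
                 z , jn-least s (le-trans s p (op-mono s o (proj₁ ∘ r))) (le-trans s q (op-mono s o (proj₂ ∘ r))) })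
            (transδ s k≤ (transδ s
              (opδ-open-≤ s o (λ i → sup-open (sgn i) λ x → w x i)
                (λ i → dense (sgn i) λ k′ kc′ k′≤u → let x , p = app i k′ kc′ k′≤u in
                  transδ (sgn i) p (sup-upper (sgn i) (λ x → e (w x i)) x)))
              (sup-least s _ _ λ { (a , p) → sup-upper s (e ∘ proj₁) (op s o a , below a p) })))
      in x , transδ s k≤b (e-mono s b≤)

  -- Complete join preservation of skeleton connectives.

  childSign-flip : ∀ π s → childSign π (flipS s) ≡ flipS (childSign π s)
  childSign-flip one s = refl
  childSign-flip ∂   s = refl

  module Skeleton (s : Sign) (o : POp (flipS s)) where
    n : ℕ
    n = ar (flipS s) o
    sgn : Fin n → Sign
    sgn i = childSign (ord (flipS s) o i) s
    h : (Fin n → A.Carrier) → A.Carrier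
    h = op (flipS s) o

    h-mono : ∀ {xs ys} → (∀ i → leA (sgn i) (xs i) (ys i)) → leA s (h xs) (h ys)
    h-mono xs≤ys = flip-out s (op-mono (flipS s) o λ i →
      subst (λ r → leA r _ _) (sym (childSign-flip (ord (flipS s) o i) s)) (flip-in (sgn i) (xs≤ys i)))

    h-bt : ∀ i xs → leA s (h (updateAt xs i (const (bt (sgn i))))) (bt s)
    h-bt i xs = flip-out s (subst (λ r → leA (flipS s) (tp (flipS s)) (h (updateAt xs i (const (tp r)))))
      (childSign-flip (ord (flipS s) o i) s)
      (≈⇒le (flipS s) (A.Eq.sym (op-tp (flipS s) o i xs))))

    h-jn : ∀ i xs a b → leA s (h (updateAt xs i (const (jn (sgn i) a b))))
                              (jn s (h (updateAt xs i (const a))) (h (updateAt xs i (const b))))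
    h-jn i xs a b = flip-out s (subst (λ r → leA (flipS s)
        (jn s (h (updateAt xs i (const a))) (h (updateAt xs i (const b))))
        (h (updateAt xs i (const (mt r a b)))))
      (childSign-flip (ord (flipS s) o i) s)
      (≈⇒le (flipS s) (A.Eq.sym (op-mt (flipS s) o i xs a b))))

    -- The inner signed infimum in the definition of the extension; at closed vectors it is the
    -- value of the extension.
    hδ : (Fin n → D.Carrier) → D.Carrier
    hδ k = inf s {I = Σ (Fin n → A.Carrier) λ a → ∀ i → leδ (sgn i) (k i) (e (a i))} (e ∘ h ∘ proj₁)

    -- Complete join preservation of the extension, in the form of an induction principle for bounds.
    hδ-joins : ∀ {p} (P : Fin n → D.Carrier → Set p) {u z} →
      (∀ i y → (∀ x → P i x → leδ (sgn i) x y) → leδ (sgn i) (u i) y) →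
      (∀ x → (∀ i → P i (x i)) → leδ s (hδ x) z) →
      leδ s (opδ (flipS s) o u) z
    hδ-joins P {u} {z} u≤P P≤z = opδ-closed-least s o λ k kc k≤u →
      flip-outδ s (dense (flipS s) λ v vo v≤z → flip-inδ s (bounded v vo (flip-outδ s v≤z) k kc k≤u))
      where
      module _ (v : D.Carrier) (vo : closed (flipS s) v) (z≤v : leδ s z v) where
        -- By compactness, for the open `v`, this says that `hδ c` lies below `v`; having one vector
        -- of `A` as evidence lets coordinates be changed separately.
        T : (Fin n → D.Carrier) → Set ℓ
        T c = Σ (Fin n → A.Carrier) λ a → (∀ i → leδ (sgn i) (c i) (e (a i))) × leδ s (e (h a)) v

        start : ∀ c → (∀ i → P i (c i)) → T c
        start c Pc =
          let b , (a , c≤a , ha≤b) , v≤b = compact-directed (flipS s) vo Above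
                ((λ i → tp (sgn i)) , (λ i → e-tp (sgn i) _) , flip-out s (bt-minimum (flipS s) _))
                (λ { (a , c≤a , p) (a′ , c≤a′ , p′) →
                   (λ i → mt (sgn i) (a i) (a′ i)) , (λ i → e-mt (sgn i) (c≤a i) (c≤a′ i)) ,
                   flip-out s (jn-least (flipS s)
                     (flip-in s (le-trans s (h-mono λ i → mt-lowerˡ (sgn i) _ _) p))
                     (flip-in s (le-trans s (h-mono λ i → mt-lowerʳ (sgn i) _ _) p′))) })
                (flip-inδ s (transδ s (inf-greatest s _ _ λ { (a , c≤a) →
                    inf-lower s (e ∘ proj₁) (h a , a , c≤a , le-refl s) })
                  (transδ s (P≤z c Pc) z≤v)))
          in a , c≤a , transδ s (e-mono s ha≤b) (flip-outδ s v≤b)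
          where
          Above : A.Carrier → Set ℓ
          Above b = Σ (Fin n → A.Carrier) λ a → (∀ i → leδ (sgn i) (c i) (e (a i))) × leA s (h a) b

        -- The possible entries at `j` of evidence for the other coordinates of `c` form a family
        -- closed under joins. Its join bounds every member of `P j`, hence `u j`, hence `x`;
        -- compactness then yields one entry above `x`.
        sweep : ∀ c j → (∀ x → P j x → T (updateAt c j (const x))) →
          ∀ x → closed (sgn j) x × leδ (sgn j) x (u j) → T (updateAt c j (const x))
        sweep c j IH x (xc , x≤u) =
          let b , (a , c≤a , ha≤v , b≤a) , x≤b = compact-directed (sgn j) xc Covered
                -- With bottom in coordinate `j` the value is bottom by normality, so the other
                -- entries can be top.
                (updateAt (λ i → tp (sgn i)) j (const (bt (sgn j))) ,
                 (λ i i≢j → subst (λ a → leδ (sgn i) (c i) (e a)) (sym (updateAt-minimal i j _ i≢j)) (e-tp (sgn i) _)) ,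
                 transδ s (e-mono s (h-bt j _)) (e-bt s v) ,
                 le-reflexive (sgn j) (sym (updateAt-updates j _)))
                -- Two vectors are combined by a join at `j` and meets elsewhere: join preservation
                -- at `j` splits the value in two, and monotonicity bounds each half.
                (λ { (a , c≤a , p , q) (a′ , c≤a′ , p′ , q′) →
                   updateAt (λ i → mt (sgn i) (a i) (a′ i)) j (const (jn (sgn j) (a j) (a′ j))) ,
                   (λ i i≢j → subst (λ a → leδ (sgn i) (c i) (e a)) (sym (updateAt-minimal i j _ i≢j))
                                (e-mt (sgn i) (c≤a i i≢j) (c≤a′ i i≢j))) ,
                   transδ s (e-mono s (h-jn j _ _ _)) (e-jn s
                     (transδ s (e-mono s (h-mono (updateAt-all (λ i y → leA (sgn i) y (a i)) j
                        (λ i _ → mt-lowerˡ (sgn i) _ _) (le-refl (sgn j))))) p)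
                     (transδ s (e-mono s (h-mono (updateAt-all (λ i y → leA (sgn i) y (a′ i)) j
                        (λ i _ → mt-lowerʳ (sgn i) _ _) (le-refl (sgn j))))) p′)) ,
                   le-trans (sgn j) (jn-least (sgn j)
                       (le-trans (sgn j) q (jn-upperˡ (sgn j) _ _)) (le-trans (sgn j) q′ (jn-upperʳ (sgn j) _ _)))
                     (le-reflexive (sgn j) (sym (updateAt-updates j _))) })
                (transδ (sgn j) x≤u (u≤P j _ λ y Py →
                  let a , c≤a , ha≤v = IH y Py in
                  transδ (sgn j) (subst (λ y → leδ (sgn j) y (e (a j))) (updateAt-updates j c) (c≤a j))
                    (sup-upper (sgn j) (e ∘ proj₁) (a j , a ,
                      (λ i i≢j → subst (λ y → leδ (sgn i) y (e (a i))) (updateAt-minimal i j c i≢j) (c≤a i)) ,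
                      ha≤v , le-refl (sgn j)))))
          in a , updateAt-all (λ i y → leδ (sgn i) y (e (a i))) j c≤a
                   (transδ (sgn j) x≤b (e-mono (sgn j) b≤a)) , ha≤v
          where
          Covered : A.Carrier → Set ℓ
          Covered b = Σ (Fin n → A.Carrier) λ a →
            (∀ i → i ≢ j → leδ (sgn i) (c i) (e (a i))) × leδ s (e (h a)) v × leA (sgn j) b (a j)

        bounded : ∀ k → (∀ i → closed (sgn i) (k i)) → (∀ i → leδ (sgn i) (k i) (u i)) → leδ s (hδ k) v
        bounded k kc k≤u =
          let a , k≤a , ha≤v = coordinatewise T
                (λ eq → λ { (a , p , q) → a , (λ i → subst (λ y → leδ (sgn i) y (e (a i))) (eq i) (p i)) , q })
                P (λ i x → closed (sgn i) x × leδ (sgn i) x (u i)) sweep start k (λ i → kc i , k≤u i)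
          in transδ s (inf-lower s (e ∘ h ∘ proj₁) (a , k≤a)) ha≤v

    hδ-closed : ∀ k → closed s (hδ k)
    hδ-closed k = inf-closed s (h ∘ proj₁)

  -- Noncritical terms and families of approximating values.

  meetT : Sign → Term → Term → Term
  meetT ⊕ = _∧t_
  meetT ⊖ = _∨t_

  opT : ∀ s (o : POp s) → (Fin (ar s o) → Term) → Term
  opT ⊕ = gapp
  opT ⊖ = fapp

  ⟦meetT⟧ : ∀ s a b y → ⟦ meetT s a b ⟧ y ≡ mt s (⟦ a ⟧ y) (⟦ b ⟧ y)
  ⟦meetT⟧ ⊕ a b y = refl
  ⟦meetT⟧ ⊖ a b y = refl

  ⟦meetT⟧δ : ∀ s a b v → ⟦ meetT s a b ⟧δ v ≡ mtδ s (⟦ a ⟧δ v) (⟦ b ⟧δ v)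
  ⟦meetT⟧δ ⊕ a b v = refl
  ⟦meetT⟧δ ⊖ a b v = refl

  ⟦opT⟧ : ∀ s o ts y → ⟦ opT s o ts ⟧ y ≡ op s o (λ i → ⟦ ts i ⟧ y)
  ⟦opT⟧ ⊕ o ts y = refl
  ⟦opT⟧ ⊖ o ts y = refl

  ⟦opT⟧δ : ∀ s o ts v → ⟦ opT s o ts ⟧δ v ≡ opδ s o (λ i → ⟦ ts i ⟧δ v)
  ⟦opT⟧δ ⊕ o ts v = refl
  ⟦opT⟧δ ⊖ o ts v = refl

  module Valuation (ε : PROP → Pol) (Ω : PROP → PROP → Set) (v : PROP → D.Carrier) where

    -- The sign of the noncritical occurrences of a variable.
    η : PROP → Sign
    η p with ε p
    ... | one = ⊖
    ... | ∂   = ⊕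

    _⊔ᵥ_ : Val → Val → Val
    (y ⊔ᵥ y′) q = jn (η q) (y q) (y′ q)

    botᵥ : Val
    botᵥ q = bt (η q)

    -- Away from `q` the default is the signed bottom, which belongs to all the families in
    -- `Ideals`.
    at : PROP → A.Carrier → Val
    at q a q′ with q′ ≟ℕ q
    ... | yes _ = a
    ... | no  _ = bt (η q′)

    at-self : ∀ q a → at q a q ≡ a
    at-self q a with q ≟ℕ q
    ... | yes _   = refl
    ... | no  q≢q = ⊥-elim (q≢q refl)

    -- `nc-const` covers the lattice constants and those nullary connectives whose sign would make
    -- them skeleton nodes.
    data Noncritical (V : PROP → Set) : Sign → Term → Set ℓ where
      nc-var   : ∀ {q} → V q → Noncritical V (η q) (var q)
      nc-const : ∀ {s t} → (∀ v h → ⟦ t ⟧δ v D.≈ e (⟦ t ⟧ h)) → Noncritical V s t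
      nc-meet  : ∀ {s a b} → Noncritical V s a → Noncritical V s b → Noncritical V s (meetT s a b)
      nc-op    : ∀ {s} o {ts} → (∀ i → Noncritical V (childSign (ord s o i) s) (ts i)) →
                 Noncritical V s (opT s o ts)

    nc-mono : ∀ {V s t} → Noncritical V s t → ∀ {y y′} → (∀ q → V q → leA (η q) (y q) (y′ q)) →
      leA s (⟦ t ⟧ y) (⟦ t ⟧ y′)
    nc-mono (nc-var Vq) y≤y′ = y≤y′ _ Vq
    nc-mono {s = s} (nc-const const-t) {y} {y′} _ =
      ≈⇒le s (A.antisym (e-reflect ⊕ (D.reflexive (D.Eq.trans (D.Eq.sym (const-t v y)) (const-t v y′))))
                        (e-reflect ⊕ (D.reflexive (D.Eq.trans (D.Eq.sym (const-t v y′)) (const-t v y)))))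
    nc-mono {s = s} (nc-meet {a = a} {b} na nb) {y} {y′} y≤y′
      rewrite ⟦meetT⟧ s a b y | ⟦meetT⟧ s a b y′ =
      mt-greatest s (le-trans s (mt-lowerˡ s _ _) (nc-mono na y≤y′))
                    (le-trans s (mt-lowerʳ s _ _) (nc-mono nb y≤y′))
    nc-mono {s = s} (nc-op o {ts} nts) {y} {y′} y≤y′
      rewrite ⟦opT⟧ s o ts y | ⟦opT⟧ s o ts y′ =
      op-mono s o λ i → nc-mono (nts i) y≤y′

    -- Demands are formulated for an arbitrary such family, since the family of admissible values
    -- can only be defined once the demands are given.
    record Ideals : Set (lsuc ℓ) where
      field
        Mem  : PROP → A.Carrier → Set ℓ
        bot  : ∀ q → Mem q (bt (η q))
        join : ∀ q {a b} → Mem q a → Mem q b → Mem q (jn (η q) a b)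

      Selection : Set ℓ
      Selection = Σ Val λ y → ∀ q → Mem q (y q)

      Tracks : PROP → Set ℓ
      Tracks q = ∀ k → closed (η q) k → leδ (η q) k (v q) → Σ A.Carrier λ a → Mem q a × leδ (η q) k (e a)

      _⊔ₛ_ : Selection → Selection → Selection
      (y , Uy) ⊔ₛ (y′ , Uy′) = (y ⊔ᵥ y′) , λ q → join q (Uy q) (Uy′ q)

      botₛ : Selection
      botₛ = botᵥ , bot

      atₛ : ∀ q a → Mem q a → Selection
      atₛ q a Ua = at q a , member
        where
        member : ∀ q′ → Mem q′ (at q a q′)
        member q′ with q′ ≟ℕ q
        ... | yes refl = Ua
        ... | no  _    = bot q′

    module _ (U : Ideals) where
      open Ideals U

      ⊔ₛ-upperˡ : ∀ (y y′ : Selection) q → leA (η q) (proj₁ y q) (proj₁ (y ⊔ₛ y′) q)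
      ⊔ₛ-upperˡ y y′ q = jn-upperˡ (η q) _ _

      ⊔ₛ-upperʳ : ∀ (y y′ : Selection) q → leA (η q) (proj₁ y′ q) (proj₁ (y ⊔ₛ y′) q)
      ⊔ₛ-upperʳ y y′ q = jn-upperʳ (η q) _ _

      -- Selections found for the subterms are joined into one; noncritical terms are monotone in
      -- the signed orders of their variables, so every bound survives.
      nc-approximates : ∀ {V s t} → (∀ q → V q → Tracks q) → Noncritical V s t →
        Approximates s (⟦ t ⟧δ v) {X = Selection} (λ y → ⟦ t ⟧ (proj₁ y))
      nc-approximates {V} {s} {t} track nt = record
        { base   = botₛ
        ; bound  = λ y y′ → (y ⊔ₛ y′) , nc-mono nt (λ q _ → ⊔ₛ-upperˡ y y′ q) , nc-mono nt (λ q _ → ⊔ₛ-upperʳ y y′ q)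
        ; approx = approximate nt
        }
        where
        approximate : ∀ {s t} → Noncritical V s t → ∀ k → closed s k → leδ s k (⟦ t ⟧δ v) →
          Σ Selection λ y → leδ s k (e (⟦ t ⟧ (proj₁ y)))
        approximate (nc-var {q} Vq) k kc k≤ =
          let a , Ua , k≤a = track q Vq k kc k≤
          in atₛ q a Ua , subst (λ b → leδ (η q) k (e b)) (sym (at-self q a)) k≤a
        approximate {s} (nc-const const-t) k kc k≤ = botₛ , transδ s k≤ (≈⇒leδ s (const-t v _))
          where
          ≈⇒leδ : ∀ s {x y} → x D.≈ y → leδ s x y
          ≈⇒leδ ⊕ eq = D.reflexive eq
          ≈⇒leδ ⊖ eq = D.reflexive (D.Eq.sym eq)
        approximate {s} (nc-meet {a = a} {b} na nb) k kc k≤ =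
          let k≤′ = subst (leδ s k) (⟦meetT⟧δ s a b v) k≤
              y  , p  = approximate na k kc (transδ s k≤′ (mtδ-lowerˡ s _ _))
              y′ , p′ = approximate nb k kc (transδ s k≤′ (mtδ-lowerʳ s _ _))
          in (y ⊔ₛ y′) , subst (λ c → leδ s k (e c)) (sym (⟦meetT⟧ s a b _)) (e-mt s
               (transδ s p  (e-mono s (nc-mono na λ q _ → ⊔ₛ-upperˡ y y′ q)))
               (transδ s p′ (e-mono s (nc-mono nb λ q _ → ⊔ₛ-upperʳ y y′ q))))
        approximate {s} (nc-op o {ts} nts) k kc k≤ =
          let y , p = Approximates.approx
                (op-approximates s o (λ y i → ⟦ ts i ⟧ (proj₁ y))
                  (record { base  = botₛ
                          ; bound = λ y y′ → (y ⊔ₛ y′) , λ i →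
                              nc-mono (nts i) (λ q _ → ⊔ₛ-upperˡ y y′ q) , nc-mono (nts i) (λ q _ → ⊔ₛ-upperʳ y y′ q) })
                  (λ i → approximate (nts i)))
                k kc (subst (leδ s k) (⟦opT⟧δ s o ts v) k≤)
          in y , subst (λ c → leδ s k (e c)) (sym (⟦opT⟧ s o ts _)) p

    -- Contexts and the conditions they impose on a valuation.

    -- K y a says that the one-hole PIA term, with side terms evaluated at y and hole filled by a, lies
    -- above a fixed closed element; x is the value of the hole under v.
    record Context (ds : List PROP) (s : Sign) (x : D.Carrier) : Set (lsuc ℓ) where
      field
        K      : Val → A.Carrier → Set ℓ
        mono   : ∀ {y y′ a a′} → (∀ q → q ∈ ds → leA (η q) (y q) (y′ q)) → leA s a a′ → K y a → K y′ a′
        meet   : ∀ {y a b} → K y a → K y b → K y (mt s a b)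
        top    : ∀ {y} → K y (tp s)
        approx : (U : Ideals) → (∀ q → q ∈ ds → Ideals.Tracks U q) →
                 ∀ {X : Set ℓ} (w : X → A.Carrier) → Approximates s x w →
                 Σ (Ideals.Selection U) λ y → Σ X λ i → K (proj₁ y) (w i)

    -- The condition left by one critical leaf. Raising the side values `y` preserves it and so does
    -- lowering the value of `target`, because the critical sign is opposite to `η target`. Critical
    -- occurrences thus bound a variable from above, occurrences in side terms from below.
    record Demand : Set (lsuc ℓ) where
      field
        target : PROP
        deps   : List PROP
        below  : ∀ {q} → q ∈ deps → Ω q target
        R      : Val → A.Carrier → Set ℓ
        mono   : ∀ {y y′ a a′} → (∀ q → q ∈ deps → leA (η q) (y q) (y′ q)) → leA (η target) a′ a → R y a → R y′ a′
        join   : ∀ {y a b} → R y a → R y b → R y (jn (η target) a b)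
        bot    : ∀ {y} → R y (bt (η target))
        approx : (U : Ideals) → (∀ q → q ∈ deps → Ideals.Tracks U q) →
                 ∀ k → closed (η target) k → leδ (η target) k (v target) →
                 Σ (Ideals.Selection U) λ y → Σ A.Carrier λ a → leδ (η target) k (e a) × R (proj₁ y) a

    -- The condition left by a subterm without critical leaves; it bounds variables from below only.
    record SideDemand : Set (lsuc ℓ) where
      field
        R      : Val → Set ℓ
        mono   : ∀ {y y′} → (∀ q → leA (η q) (y q) (y′ q)) → R y → R y′
        approx : (U : Ideals) → (∀ q → Ideals.Tracks U q) → Σ (Ideals.Selection U) λ y → R (proj₁ y)

    Met : Val → Demand → Set ℓ
    Met h d = Demand.R d h (h (Demand.target d))

    record Decomposition (K : Val → Set ℓ) : Set (lsuc ℓ) where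
      field
        demands : List Demand
        sides   : List SideDemand
        sound   : ∀ h → AllList (Met h) demands → AllList (λ d → SideDemand.R d h) sides → K h

    both : ∀ {K K′ K″} → Decomposition K → Decomposition K′ → (∀ h → K h → K′ h → K″ h) → Decomposition K″
    both δ δ′ f = record
      { demands = demands δ ++ demands δ′
      ; sides   = sides δ ++ sides δ′
      ; sound   = λ h ms ss → f h (sound δ h (++⁻ˡ (demands δ) ms) (++⁻ˡ (sides δ) ss))
                                  (sound δ′ h (++⁻ʳ (demands δ) ms) (++⁻ʳ (sides δ) ss))
      }
      where open Decomposition

    weaken : ∀ {K K′} → Decomposition K → (∀ h → K h → K′ h) → Decomposition K′
    weaken δ f = record { Decomposition δ hiding (sound) ; sound = λ h ms ss → f h (Decomposition.sound δ h ms ss) }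

    every : ∀ {n} (K : Fin n → Val → Set ℓ) → (∀ i → Decomposition (K i)) → Decomposition (λ h → ∀ i → K i h)
    every {zero}  K δ = record { demands = [] ; sides = [] ; sound = λ h _ _ () }
    every {suc n} K δ = both (δ zero) (every (K ∘ suc) (δ ∘ suc)) λ { h p q zero → p ; h p q (suc i) → q i }

    -- Decomposition of PIA terms into demands.

    -- ds collects the variables of the side terms on the path from the root.
    data PIA (ds : List PROP) : Sign → Term → Set ℓ where
      pia-nc   : ∀ {s t} → Noncritical (λ _ → 𝟙) s t → PIA ds s t
      pia-crit : ∀ {p} → (∀ {q} → q ∈ ds → Ω q p) → PIA ds (flipS (η p)) (var p)
      pia-meet : ∀ {s a b} → PIA ds s a → PIA ds s b → PIA ds s (meetT s a b)
      pia-op   : ∀ {s} o i {ts ds′} → (∀ {q} → q ∈ ds → q ∈ ds′) →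
                (∀ j → j ≢ i → Noncritical (_∈ ds′) (childSign (ord s o j) s) (ts j)) →
                PIA ds′ (childSign (ord s o i) s) (ts i) → PIA ds s (opT s o ts)

    demand : ∀ {ds p} → (∀ {q} → q ∈ ds → Ω q p) → Context ds (flipS (η p)) (v p) → Demand
    demand {ds} {p} below C = record
      { target = p ; deps = ds ; below = below
      ; R = K ; mono = λ y≤ a≤ → mono y≤ (flip-in (η p) a≤) ; join = meet ; bot = top
      ; approx = λ U track k kc k≤ →
          -- The elements of `A` above `k` approximate `v p` from the opposite side, by
          -- interpolation. The context then picks one of them, which is a value for the target
          -- above `k`.
          let y , (a , k≤a) , r = approx U track {X = Σ A.Carrier λ a → leδ (η p) k (e a)} proj₁ (record
                { base   = tp (η p) , e-tp (η p) k
                ; bound  = λ { (a , k≤a) (b , k≤b) → (mt (η p) a b , e-mt (η p) k≤a k≤b) ,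
                             flip-in (η p) (mt-lowerˡ (η p) a b) , flip-in (η p) (mt-lowerʳ (η p) a b) }
                ; approx = λ o oc o≤ →
                    let a , k≤a , a≤o = interpolate (η p) kc oc (transδ (η p) k≤ (flip-outδ (η p) o≤))
                    in (a , k≤a) , flip-inδ (η p) a≤o })
          in y , a , k≤a , r
      }
      where open Context C

    sideDemand : ∀ {ds s t} → Noncritical (λ _ → 𝟙) s t → Context ds s (⟦ t ⟧δ v) → SideDemand
    sideDemand {t = t} nt C = record
      { R = λ y → K y (⟦ t ⟧ y)
      ; mono = λ y≤ → mono (λ q _ → y≤ q) (nc-mono nt λ q _ → y≤ q)
      ; approx = λ U track →
          let open Ideals U
              y , y′ , r = approx U (λ q _ → track q) _ (nc-approximates U (λ q _ → track q) nt)
          in (y ⊔ₛ y′) , mono (λ q _ → ⊔ₛ-upperˡ U y y′ q) (nc-mono nt λ q _ → ⊔ₛ-upperʳ U y y′ q) r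
      }
      where open Context C

    widen : ∀ {ds s x x′} → leδ s x x′ → Context ds s x → Context ds s x′
    widen {s = s} x≤ C = record
      { Context C hiding (approx)
      ; approx = λ U track w ap → Context.approx C U track w
          (record { Approximates ap hiding (approx) ; approx = λ k kc k≤ → Approximates.approx ap k kc (transδ s k≤ x≤) })
      }

    -- The new hole is a coordinate of the connective, which preserves meets there. Selections for
    -- the side terms, paired with a family for the hole, give a directed family of argument
    -- vectors.
    descend : ∀ {ds ds′ s} o i {ts} → (∀ {q} → q ∈ ds → q ∈ ds′) →
      (∀ j → j ≢ i → Noncritical (_∈ ds′) (childSign (ord s o j) s) (ts j)) →
      Context ds s (⟦ opT s o ts ⟧δ v) → Context ds′ (childSign (ord s o i) s) (⟦ ts i ⟧δ v)
    descend {ds} {ds′} {s} o i {ts} ds⊆ nts C = record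
      { K = λ y a → K y (plug y a)
      ; mono = λ y≤ a≤ → mono (λ q q∈ → y≤ q (ds⊆ q∈)) (op-mono s o (fill-mono y≤ a≤))
      ; meet = λ {y} {a} {b} ka kb → mono (λ q _ → le-refl (η q)) (≈⇒le s (A.Eq.sym (op-mt s o i _ a b))) (meet ka kb)
      ; top = mono (λ q _ → le-refl (η q)) (≈⇒le s (A.Eq.sym (op-tp s o i _))) top
      ; approx = λ U track w ap → plugged U track w ap
      }
      where
      open Context C
      sgn : ∀ j → Sign
      sgn j = childSign (ord s o j) s
      fill : Val → A.Carrier → Fin (ar s o) → A.Carrier
      fill y a = updateAt (λ j → ⟦ ts j ⟧ y) i (const a)
      plug : Val → A.Carrier → A.Carrier
      plug y a = op s o (fill y a)
      fill-mono : ∀ {y y′ a a′} → (∀ q → q ∈ ds′ → leA (η q) (y q) (y′ q)) → leA (sgn i) a a′ →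
        ∀ j → leA (sgn j) (fill y a j) (fill y′ a′ j)
      fill-mono y≤ a≤ = updateAt-rel (λ j → leA (sgn j)) i (λ j j≢i → nc-mono (nts j j≢i) y≤) a≤

      plugged : (U : Ideals) → (∀ q → q ∈ ds′ → Ideals.Tracks U q) →
        ∀ {X : Set ℓ} (w : X → A.Carrier) → Approximates (sgn i) (⟦ ts i ⟧δ v) w →
        Σ (Ideals.Selection U) λ y → Σ X λ x → K (proj₁ y) (plug (proj₁ y) (w x))
      plugged U track {X} w ap =
        -- `y` serves the outer context and `y′` the side terms of this connective; their join
        -- serves both.
        let y , (y′ , x) , r = approx U (λ q q∈ → track q (ds⊆ q∈)) (λ { (y , x) → plug (proj₁ y) (w x) })
              (subst (λ z → Approximates s z (λ { (y , x) → plug (proj₁ y) (w x) })) (sym (⟦opT⟧δ s o ts v))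
                (op-approximates s o {X = Selection × X} (λ { (y , x) → fill (proj₁ y) (w x) }) directed component))
        in (y ⊔ₛ y′) , x , mono (λ q _ → ⊔ₛ-upperˡ U y y′ q)
             (op-mono s o (fill-mono (λ q _ → ⊔ₛ-upperʳ U y y′ q) (le-refl (sgn i)))) r
        where
        open Ideals U
        module ap = Approximates ap
        directed : Directed sgn {X = Selection × X} (λ { (y , x) → fill (proj₁ y) (w x) })
        directed = record
          { base  = botₛ , ap.base
          ; bound = λ { (y , x) (y′ , x′) → let z , p , p′ = ap.bound x x′ in
              (y ⊔ₛ y′ , z) , λ j → fill-mono (λ q _ → ⊔ₛ-upperˡ U y y′ q) p j , fill-mono (λ q _ → ⊔ₛ-upperʳ U y y′ q) p′ j }
          }
        component : ∀ j k → closed (sgn j) k → leδ (sgn j) k (⟦ ts j ⟧δ v) →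
          Σ (Selection × X) λ { (y , x) → leδ (sgn j) k (e (fill (proj₁ y) (w x) j)) }
        component j k kc k≤ with j ≟F i
        ... | yes refl = let x , p = ap.approx k kc k≤ in
              (botₛ , x) , subst (λ a → leδ (sgn j) k (e a)) (sym (updateAt-updates j _)) p
        ... | no  j≢i  = let y , p = Approximates.approx (nc-approximates U track (nts j j≢i)) k kc k≤ in
              (y , ap.base) , subst (λ a → leδ (sgn j) k (e a)) (sym (updateAt-minimal j i _ j≢i)) p

    -- The hole moves towards the leaves: a meet passes the context to both sides, a connective
    -- extends it, and a critical leaf or noncritical subterm turns it into a condition.
    decompose : ∀ {ds s t} → PIA ds s t → (C : Context ds s (⟦ t ⟧δ v)) →
      Decomposition (λ h → Context.K C h (⟦ t ⟧ h))
    decompose (pia-nc nt) C = record { demands = [] ; sides = sideDemand nt C ∷ [] ; sound = λ { h _ (r ∷ []) → r } }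
    decompose (pia-crit below) C = record { demands = demand below C ∷ [] ; sides = [] ; sound = λ { h (r ∷ []) _ → r } }
    decompose {s = s} (pia-meet {a = a} {b} ca cb) C =
      both (decompose ca (widen (subst (λ z → leδ s z _) (sym (⟦meetT⟧δ s a b v)) (mtδ-lowerˡ s _ _)) C))
           (decompose cb (widen (subst (λ z → leδ s z _) (sym (⟦meetT⟧δ s a b v)) (mtδ-lowerʳ s _ _)) C))
           λ h p q → subst (Context.K C h) (sym (⟦meetT⟧ s a b h)) (Context.meet C p q)
    decompose {s = s} (pia-op o i {ts} ds⊆ nts c) C =
      weaken (decompose c (descend o i ds⊆ nts C)) λ h r →
        subst (Context.K C h) (sym (⟦opT⟧ s o ts h))
          (Context.mono C (λ q _ → le-refl (η q))
            (≈⇒le s (op-cong s o (updateAt-all (λ j a → a A.≈ ⟦ ts j ⟧ h) i (λ _ _ → A.Eq.refl) A.Eq.refl))) r)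

    decompose-≤ : ∀ {s t k} → PIA [] s t → closed s k → leδ s k (⟦ t ⟧δ v) →
      Decomposition (λ h → leδ s k (e (⟦ t ⟧ h)))
    decompose-≤ {s} {t} {k} c kc k≤ = decompose c (record
      { K = λ y a → leδ s k (e a)
      ; mono = λ _ a≤ p → transδ s p (e-mono s a≤)
      ; meet = e-mt s
      ; top = e-tp s k
      ; approx = λ U _ w ap → let x , p = Approximates.approx ap k kc k≤ in Ideals.botₛ U , x , p
      })

    -- Simultaneous solution of finitely many demands.

    module Solve (spo : IsStrictPartialOrder _≡_ Ω) (ds : List Demand) (ss : List SideDemand) where
      module Ω = IsStrictPartialOrder spo

      n : ℕ
      n = length ds
      module _ (i : Fin n) where
        open Demand (lookup ds i) public using () renaming
          (target to tgt; deps to dps; below to dps-below; R to Req; mono to Req-mono; join to Req-join; bot to Req-bot; approx to Req-approx)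

      -- Indexing by positions instead of demands keeps this in Set ℓ.
      data Admissible (p : PROP) (a : A.Carrier) : Set ℓ where
        adm : (y : ∀ i → p ≡ tgt i → Val) →
              (∀ i eq q → q ∈ dps i → Admissible q (y i eq q)) →
              (∀ i eq → Req i (y i eq) a) → Admissible p a

      -- `Ω` itself may have infinite chains in both directions. Restricted to the finitely many
      -- side variables it supports induction from small variables, restricted to targets it
      -- supports recursion from large ones.
      _◁_ _▷_ : PROP → PROP → Set
      q ◁ p = q ∈ concat (tabulate dps) × Ω q p
      q ▷ p = q ∈ tabulate tgt × Ω p q

      ◁-wf : WellFounded _◁_
      ◁-wf = finite-wellFounded Ω.trans (Ω.irrefl refl) _

      ▷-wf : WellFounded _▷_
      ▷-wf = finite-wellFounded (λ p q → Ω.trans q p) (Ω.irrefl refl) _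

      dps-◁ : ∀ i {q} → q ∈ dps i → q ◁ tgt i
      dps-◁ i q∈ = ∈-concat⁺′ q∈ (∈-tabulate⁺ i) , dps-below i q∈

      dps-▷ : ∀ i {q} → q ∈ dps i → tgt i ▷ q
      dps-▷ i q∈ = ∈-tabulate⁺ i , dps-below i q∈

      adm-bot : ∀ p → Acc _◁_ p → Admissible p (bt (η p))
      adm-bot p (acc rs) = adm (λ _ _ → botᵥ)
        (λ { i refl q q∈ → adm-bot q (rs (dps-◁ i q∈)) })
        (λ { i refl → Req-bot i })

      -- Once the side values are joined, both requirements hold at the same side values, where
      -- `Req-join` applies.
      adm-join : ∀ p {a b} → Admissible p a → Admissible p b → Admissible p (jn (η p) a b)
      adm-join p (adm y m r) (adm y′ m′ r′) = adm (λ i eq → y i eq ⊔ᵥ y′ i eq)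
        (λ i eq q q∈ → adm-join q (m i eq q q∈) (m′ i eq q q∈))
        (λ { i refl → Req-join i
               (Req-mono i (λ q _ → jn-upperˡ (η q) _ _) (le-refl (η p)) (r i refl))
               (Req-mono i (λ q _ → jn-upperʳ (η q) _ _) (le-refl (η p)) (r′ i refl)) })

      U : Ideals
      U = record { Mem = Admissible ; bot = λ q → adm-bot q (◁-wf q) ; join = adm-join }
      open Ideals U using (Selection; Tracks; botₛ; _⊔ₛ_)

      -- The smaller variables are tracked by induction, so each demand on `p` has a solution above
      -- `k`. The finite meet of the solutions stays above `k` and, lying below each of them,
      -- satisfies all demands on `p`.
      tracks : ∀ p → Acc _◁_ p → Tracks p
      tracks p (acc rs) k kc k≤ =
        ⨅ (η p) (value ∘ choice) ,
        adm (λ i _ → proj₁ (proj₁ (choice i))) (λ i _ q _ → proj₂ (proj₁ (choice i)) q)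
            (λ i eq → Req-mono i (λ q _ → le-refl (η q))
                        (subst (λ r → leA (η r) (⨅ (η p) (value ∘ choice)) (value (choice i))) eq (⨅-lower (η p) (value ∘ choice) i))
                        (proj₂ (proj₂ (proj₂ (choice i))) eq)) ,
        ⨅-closed (η p) (λ a → leδ (η p) k (e a)) (e-tp (η p) k) (e-mt (η p)) _ (λ i → proj₁ (proj₂ (proj₂ (choice i))))
        where
        Choice : Fin n → Set ℓ
        Choice i = Σ Selection λ y → Σ A.Carrier λ a → leδ (η p) k (e a) × (p ≡ tgt i → Req i (proj₁ y) a)
        value : ∀ {i} → Choice i → A.Carrier
        value = proj₁ ∘ proj₂
        choice : ∀ i → Choice i
        choice i with p ≟ℕ tgt i
        ... | yes refl = let y , a , k≤a , r = Req-approx i U (λ q q∈ → tracks q (rs (dps-◁ i q∈))) k kc k≤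
                         in y , a , k≤a , λ _ → r
        -- A demand on another variable contributes the top, which is neutral in the meet.
        ... | no  p≢   = botₛ , tp (η p) , e-tp (η p) k , λ p≡ → ⊥-elim (p≢ p≡)

      sides-met : ∀ ss → Σ Selection λ y → AllList (λ d → SideDemand.R d (proj₁ y)) ss
      sides-met [] = botₛ , []
      sides-met (d ∷ ds) =
        let y , r = SideDemand.approx d U (λ q → tracks q (◁-wf q))
            y′ , rs = sides-met ds
        in (y ⊔ₛ y′) , SideDemand.mono d (⊔ₛ-upperˡ U y y′) r ∷
             mapAll (λ {d} → SideDemand.mono d (⊔ₛ-upperʳ U y y′)) rs

      start : Selection
      start = proj₁ (sides-met ss)

      Point : PROP → Set ℓ
      Point p = Σ A.Carrier (Admissible p)

      joinₚ : ∀ p {m} → (Fin m → Point p) → Point p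
      joinₚ p {zero}  g = bt (η p) , adm-bot p (◁-wf p)
      joinₚ p {suc m} g = jn (η p) (proj₁ (g zero)) (proj₁ (joinₚ p (g ∘ suc))) ,
                          adm-join p (proj₂ (g zero)) (proj₂ (joinₚ p (g ∘ suc)))

      joinₚ-upper : ∀ p {m} (g : Fin m → Point p) i → leA (η p) (proj₁ (g i)) (proj₁ (joinₚ p g))
      joinₚ-upper p g zero    = jn-upperˡ (η p) _ _
      joinₚ-upper p g (suc i) = le-trans (η p) (joinₚ-upper p (g ∘ suc) i) (jn-upperʳ (η p) _ _)

      joinₚ-cong : ∀ p {m} {g g′ : Fin m → Point p} → (∀ i → g i ≡ g′ i) → joinₚ p g ≡ joinₚ p g′
      joinₚ-cong p {zero}  eq = refl
      joinₚ-cong p {suc m} eq = cong₂ (λ { (a , x) (b , y) → jn (η p) a b , adm-join p x y })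
                                  (eq zero) (joinₚ-cong p (eq ∘ suc))

      -- An admissible value carries side values that solve its demands; these are what the smaller
      -- variables have to dominate.
      witness : ∀ i → Point (tgt i) → Val
      witness i (a , adm y m r) = y i refl

      witness-adm : ∀ i (x : Point (tgt i)) {q} → q ∈ dps i → Admissible q (witness i x q)
      witness-adm i (a , adm y m r) q∈ = m i refl _ q∈

      witness-req : ∀ i (x : Point (tgt i)) → Req i (witness i x) (proj₁ x)
      witness-req i (a , adm y m r) = r i refl

      -- `x` waits for a membership proof because the recursive value at the target is available
      -- only when the target lies above `q`.
      contribution : ∀ {q} i → Dec (q ∈ dps i) → (q ∈ dps i → Point (tgt i)) → Point q
      contribution     i (yes q∈) x = witness i (x q∈) _ , witness-adm i (x q∈) q∈
      contribution {q} i (no _)   x = bt (η q) , adm-bot q (◁-wf q)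

      contribution-cong : ∀ {q} i (d : Dec (q ∈ dps i)) {x x′} → (∀ q∈ → x q∈ ≡ x′ q∈) →
        contribution i d x ≡ contribution i d x′
      contribution-cong i (yes q∈) eq = cong (λ x → witness i x _ , witness-adm i x q∈) (eq q∈)
      contribution-cong i (no _)   eq = refl

      contribution-witness : ∀ {q} i (d : Dec (q ∈ dps i)) → q ∈ dps i → (x : Point (tgt i)) →
        proj₁ (contribution i d (λ _ → x)) ≡ witness i x q
      contribution-witness i (yes _) _  x = refl
      contribution-witness i (no q∉) q∈ x = ⊥-elim (q∉ q∈)

      contributions : ∀ p → WfRec _▷_ Point p → Fin (suc n) → Point p
      -- The extra index makes the final value dominate the solution of the side demands.
      contributions p IH zero    = proj₁ start p , proj₂ start p
      contributions p IH (suc i) = contribution i (p ∈? dps i) (λ p∈ → IH (dps-▷ i p∈))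

      -- A value for p must be improved for every demand whose side terms contain p, and the targets of
      -- these demands lie above p: hence the recursion descends from large to small variables.
      next : ∀ p → WfRec _▷_ Point p → Point p
      next p IH = joinₚ p (contributions p IH)

      -- Unfolding a well-founded recursion without function extensionality requires that the step
      -- respects pointwise equal recursive values.
      next-cong : ∀ p {IH IH′ : WfRec _▷_ Point p} → (∀ {q} q▷p → IH {q} q▷p ≡ IH′ q▷p) → next p IH ≡ next p IH′
      next-cong p {IH} {IH′} eq = joinₚ-cong p {g = contributions p IH} {contributions p IH′} λ
        { zero    → refl
        ; (suc i) → contribution-cong i (p ∈? dps i) λ p∈ → eq (dps-▷ i p∈) }

      point : ∀ p → Point p
      point = All.wfRec ▷-wf ℓ Point next

      h : Val
      h p = proj₁ (point p)

      point-next : ∀ p → point p ≡ next p (λ {q} _ → point q)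
      point-next p = FixPoint.unfold-wfRec ▷-wf Point next next-cong

      start≤h : ∀ q → leA (η q) (proj₁ start q) (h q)
      start≤h q = subst (λ x → leA (η q) (proj₁ start q) (proj₁ x)) (sym (point-next q)) (joinₚ-upper q (contributions q (λ {p} _ → point p)) zero)

      witness≤h : ∀ i {q} → q ∈ dps i → leA (η q) (witness i (point (tgt i)) q) (h q)
      witness≤h i {q} q∈ = subst (λ x → leA (η q) (witness i (point (tgt i)) q) (proj₁ x)) (sym (point-next q))
        (le-trans (η q) (le-reflexive (η q) (sym (contribution-witness i (q ∈? dps i) q∈ (point (tgt i)))))
          (joinₚ-upper q (contributions q (λ {p} _ → point p)) (suc i)))

      -- The value of `h` at a target satisfies the demand together with its own witness, and `h`
      -- dominates this witness on the side variables.
      demands-met : AllList (Met h) ds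
      demands-met = all-lookup ds λ i →
        Req-mono i (λ q q∈ → witness≤h i q∈) (le-refl (η (tgt i))) (witness-req i (point (tgt i)))

      all-sides-met : AllList (λ d → SideDemand.R d h) ss
      all-sides-met = mapAll (λ {d} → SideDemand.mono d start≤h) (proj₂ (sides-met ss))

    solve : IsStrictPartialOrder _≡_ Ω → ∀ {K} → Decomposition K → Σ Val K
    solve spo δ = h , Decomposition.sound δ h demands-met all-sides-met
      where open Solve spo (Decomposition.demands δ) (Decomposition.sides δ)

    -- From conditions on branches to the structure of PIA terms.

    critical-sign : ∀ s {p} → Critical ε s p → s ≡ flipS (η p)
    critical-sign ⊕ {p} eq with ε p
    critical-sign ⊕ refl | one = refl
    critical-sign ⊖ {p} eq with ε p
    critical-sign ⊖ refl | ∂ = refl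

    noncritical-sign : ∀ s {p} → Critical (opε ε) s p → s ≡ η p
    noncritical-sign ⊕ {p} eq with ε p
    noncritical-sign ⊕ refl | ∂ = refl
    noncritical-sign ⊖ {p} eq with ε p
    noncritical-sign ⊖ refl | one = refl

    critical? : ∀ s p → Critical (opε ε) s p ⊎ Critical ε s p
    critical? ⊕ p with ε p
    ... | one = inj₂ refl
    ... | ∂   = inj₁ refl
    critical? ⊖ p with ε p
    ... | one = inj₁ refl
    ... | ∂   = inj₂ refl

    -- Every node lies on some branch, so a condition on all branches constrains the root; this
    -- excludes skeleton roots of positive arity.
    branch : ∀ s t → Branch s t
    branch s (var p)  = end _
    branch s ⊥t       = end _
    branch s ⊤t       = end _
    branch s (a ∧t b) = step ∧l (branch s a)
    branch s (a ∨t b) = step ∨l (branch s a)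
    branch s (fapp f ts) with empty-or-inhabited (arF f)
    ... | inj₁ nullary = end nullary
    ... | inj₂ i       = step (fc i) (branch _ (ts i))
    branch s (gapp g ts) with empty-or-inhabited (arG g)
    ... | inj₁ nullary = end nullary
    ... | inj₂ i       = step (gc i) (branch _ (ts i))

    vars : Term → List PROP
    vars (var p)     = p ∷ []
    vars ⊥t          = []
    vars ⊤t          = []
    vars (a ∧t b)    = vars a ++ vars b
    vars (a ∨t b)    = vars a ++ vars b
    vars (fapp f ts) = concat (tabulate λ i → vars (ts i))
    vars (gapp g ts) = concat (tabulate λ i → vars (ts i))

    branch⇒vars : ∀ {s t q} (b : Branch s t) → endTerm b ≡ var q → q ∈ vars t
    branch⇒vars (end _) refl = here refl
    branch⇒vars {t = a ∧t b} (step ∧l br) eq = ∈-++⁺ˡ (branch⇒vars br eq)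
    branch⇒vars {t = a ∧t b} (step ∧r br) eq = ∈-++⁺ʳ (vars a) (branch⇒vars br eq)
    branch⇒vars {t = a ∨t b} (step ∨l br) eq = ∈-++⁺ˡ (branch⇒vars br eq)
    branch⇒vars {t = a ∨t b} (step ∨r br) eq = ∈-++⁺ʳ (vars a) (branch⇒vars br eq)
    branch⇒vars (step (fc {ts = ts} i) br) eq = ∈-concat⁺′ (branch⇒vars br eq) (∈-tabulate⁺ {f = λ i → vars (ts i)} i)
    branch⇒vars (step (gc {ts = ts} i) br) eq = ∈-concat⁺′ (branch⇒vars br eq) (∈-tabulate⁺ {f = λ i → vars (ts i)} i)

    vars⇒branch : ∀ s t {q} → q ∈ vars t → Σ (Branch s t) λ b → endTerm b ≡ var q
    vars⇒branch s (var p) (here refl) = end _ , refl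
    vars⇒branch s (a ∧t b) q∈ with ∈-++⁻ (vars a) q∈
    ... | inj₁ q∈a = let br , eq = vars⇒branch s a q∈a in step ∧l br , eq
    ... | inj₂ q∈b = let br , eq = vars⇒branch s b q∈b in step ∧r br , eq
    vars⇒branch s (a ∨t b) q∈ with ∈-++⁻ (vars a) q∈
    ... | inj₁ q∈a = let br , eq = vars⇒branch s a q∈a in step ∨l br , eq
    ... | inj₂ q∈b = let br , eq = vars⇒branch s b q∈b in step ∨r br , eq
    vars⇒branch s (fapp f ts) q∈ with ∈-concat⁻′ _ q∈
    ... | xs , q∈xs , xs∈ with ∈-tabulate⁻ {f = λ i → vars (ts i)} xs∈
    ... | i , refl = let br , eq = vars⇒branch _ (ts i) q∈xs in step (fc i) br , eq
    vars⇒branch s (gapp g ts) q∈ with ∈-concat⁻′ _ q∈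
    ... | xs , q∈xs , xs∈ with ∈-tabulate⁻ {f = λ i → vars (ts i)} xs∈
    ... | i , refl = let br , eq = vars⇒branch _ (ts i) q∈xs in step (gc i) br , eq

    contains-critical? : ∀ s t → AgreesOpp ε s t ⊎ ContainsCritical ε s t
    contains-critical? s (var p) with critical? s p
    ... | inj₁ c = inj₁ λ { (end _) q refl → c }
    ... | inj₂ c = inj₂ (end _ , p , refl , c)
    contains-critical? s ⊥t = inj₁ λ { (end _) q () }
    contains-critical? s ⊤t = inj₁ λ { (end _) q () }
    contains-critical? s (a ∧t b) with contains-critical? s a | contains-critical? s b
    ... | inj₂ (br , c) | _             = inj₂ (step ∧l br , c)
    ... | inj₁ _        | inj₂ (br , c) = inj₂ (step ∧r br , c)
    ... | inj₁ na       | inj₁ nb       = inj₁ λ { (step ∧l br) → na br ; (step ∧r br) → nb br }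
    contains-critical? s (a ∨t b) with contains-critical? s a | contains-critical? s b
    ... | inj₂ (br , c) | _             = inj₂ (step ∨l br , c)
    ... | inj₁ _        | inj₂ (br , c) = inj₂ (step ∨r br , c)
    ... | inj₁ na       | inj₁ nb       = inj₁ λ { (step ∨l br) → na br ; (step ∨r br) → nb br }
    contains-critical? s (fapp f ts) with all-or-some (λ i → contains-critical? (childSign (ordF f i) s) (ts i))
    ... | inj₁ n            = inj₁ λ { (end _) q () ; (step (fc i) br) → n i br }
    ... | inj₂ (i , br , c) = inj₂ (step (fc i) br , c)
    contains-critical? s (gapp g ts) with all-or-some (λ i → contains-critical? (childSign (ordG g i) s) (ts i))
    ... | inj₁ n            = inj₁ λ { (end _) q () ; (step (gc i) br) → n i br }
    ... | inj₂ (i , br , c) = inj₂ (step (gc i) br , c)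

    -- All order conditions on an empty vector are vacuous, so both layers of the extension reduce
    -- to the constant.
    opδ-nullary : ∀ s o → ar s o ≡ 0 → ∀ {u xs} → opδ s o u D.≈ e (op s o xs)
    opδ-nullary ⊖ f eq {xs = xs} = D.antisym
      (D.⋁-least _ _ λ _ → D.⋀-lower _ (xs , λ i → empty eq i))
      (D.trans (D.⋀-great _ _ λ _ → e-mono ⊕ (A.reflexive (op-cong ⊖ f λ i → empty eq i)))
               (D.⋁-upper _ ((λ _ → D.⊤) , (λ i → empty eq i) , (λ i → empty eq i))))
    opδ-nullary ⊕ g eq {xs = xs} = D.antisym
      (D.trans (D.⋀-lower _ ((λ _ → D.⊤) , (λ i → empty eq i) , (λ i → empty eq i)))
               (D.⋁-least _ _ λ _ → e-mono ⊕ (A.reflexive (op-cong ⊕ g λ i → empty eq i))))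
      (D.⋀-great _ _ λ _ → D.⋁-upper _ (xs , λ i → empty eq i))

    noncritical : ∀ {V} s t → InternalPIA s t →
      (∀ (b : Branch s t) q → endTerm b ≡ var q → Critical (opε ε) (endSign b) q × V q) → Noncritical V s t
    noncritical {V} s (var p) _ H with H (end _) p refl
    ... | c , Vp with noncritical-sign s c
    ... | refl = nc-var Vp
    noncritical s ⊥t _ H = nc-const λ _ _ → D.Eq.sym D.e-⊥
    noncritical s ⊤t _ H = nc-const λ _ _ → D.Eq.sym D.e-⊤
    noncritical ⊕ (a ∧t b) I H = nc-meet
      (noncritical ⊕ a (λ br → proj₂ (I (step ∧l br))) (λ br → H (step ∧l br)))
      (noncritical ⊕ b (λ br → proj₂ (I (step ∧r br))) (λ br → H (step ∧r br)))
    noncritical ⊖ (a ∧t b) I H with () ← proj₁ (I (step ∧l (branch ⊖ a)))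
    noncritical ⊖ (a ∨t b) I H = nc-meet
      (noncritical ⊖ a (λ br → proj₂ (I (step ∨l br))) (λ br → H (step ∨l br)))
      (noncritical ⊖ b (λ br → proj₂ (I (step ∨r br))) (λ br → H (step ∨r br)))
    noncritical ⊕ (a ∨t b) I H with () ← proj₁ (I (step ∨l (branch ⊕ a)))
    noncritical ⊕ (gapp g ts) I H = nc-op g λ i →
      noncritical _ (ts i) (λ br → proj₂ (I (step (gc i) br))) (λ br → H (step (gc i) br))
    noncritical ⊖ (fapp f ts) I H = nc-op f λ i →
      noncritical _ (ts i) (λ br → proj₂ (I (step (fc i) br))) (λ br → H (step (fc i) br))
    noncritical ⊖ (gapp g ts) I H with empty-or-inhabited (arG g)
    -- A nullary connective is a leaf of the tree, whatever the kind of its node.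
    ... | inj₁ nullary = nc-const λ _ _ → opδ-nullary ⊕ g nullary
    ... | inj₂ i with () ← proj₁ (I (step (gc i) (branch _ (ts i))))
    noncritical ⊕ (fapp f ts) I H with empty-or-inhabited (arF f)
    ... | inj₁ nullary = nc-const λ _ _ → opδ-nullary ⊖ f nullary
    ... | inj₂ i with () ← proj₁ (I (step (fc i) (branch _ (ts i))))

    Sidewise : PROP → Sign → Term → Set
    Sidewise p s γ = AgreesOpp ε s γ × VarsBelow Ω p s γ

    CriticalBranches : List PROP → Sign → Term → Set
    CriticalBranches ds s t = ∀ (b : Branch s t) p → endTerm b ≡ var p → Critical ε (endSign b) p →
      SRRok (Sidewise p) b × (∀ {q} → q ∈ ds → Ω q p)

    child : ∀ s o {ts} i → Child s (opT s o ts) (childSign (ord s o i) s) (ts i)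
    child ⊕ g i = gc i
    child ⊖ f i = fc i

    -- A sibling other than `i` forces arity at least two, so the node is SRR and its side condition
    -- applies.
    siblings : ∀ s o {ts} i {P} → SRRcond P (child s o {ts} i) →
      ∀ j → j ≢ i → P (childSign (ord s o j) s) (ts j)
    siblings ⊕ g i srr j j≢i = srr (≢⇒2≤ i j j≢i) j j≢i
    siblings ⊖ f i srr j j≢i = srr (≢⇒2≤ i j j≢i) j j≢i

    -- A critical leaf below child `i` forces all other children to agree with the opposite
    -- order-type, so at most one child contains critical leaves.
    pia-node : ∀ {ds} s o ts → InternalPIA s (opT s o ts) → CriticalBranches ds s (opT s o ts) →
      (∀ i ds′ → InternalPIA (childSign (ord s o i) s) (ts i) →
        CriticalBranches ds′ (childSign (ord s o i) s) (ts i) → PIA ds′ (childSign (ord s o i) s) (ts i)) →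
      PIA ds s (opT s o ts)
    pia-node {ds} s o ts I H rec with all-or-some (λ i → contains-critical? (childSign (ord s o i) s) (ts i))
    ... | inj₁ agree = pia-nc (nc-op o λ i →
            noncritical _ (ts i) (λ br → proj₂ (I (step (child s o i) br))) (λ br q eq → agree i br q eq , _))
    ... | inj₂ (i , br , p , eq , c) = pia-op o i (∈-++⁺ʳ side) sides (rec i (side ++ ds)
            (λ br → proj₂ (I (step (child s o i) br)))
            (λ br p eq c → proj₂ (proj₁ (H (step (child s o i) br) p eq c)) , λ q∈ → below br p eq c q∈))
      where
      sideOf : Fin (ar s o) → List PROP
      sideOf j with j ≟F i
      ... | yes _ = []
      ... | no  _ = vars (ts j)
      side : List PROP
      side = concat (tabulate sideOf)

      into-side : ∀ j → j ≢ i → ∀ {q} → q ∈ vars (ts j) → q ∈ sideOf j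
      into-side j j≢i q∈ with j ≟F i
      ... | yes j≡i = ⊥-elim (j≢i j≡i)
      ... | no  _   = q∈

      from-side : ∀ j {q} → q ∈ sideOf j → j ≢ i × q ∈ vars (ts j)
      from-side j q∈ with j ≟F i
      from-side j () | yes _
      from-side j q∈ | no j≢i = j≢i , q∈

      conditions : ∀ (br : Branch _ (ts i)) p → endTerm br ≡ var p → Critical ε (endSign br) p →
        ∀ j → j ≢ i → Sidewise p (childSign (ord s o j) s) (ts j)
      conditions br p eq c = siblings s o i {Sidewise p} (proj₁ (proj₁ (H (step (child s o i) br) p eq c)))

      sides : ∀ j → j ≢ i → Noncritical (_∈ side ++ ds) (childSign (ord s o j) s) (ts j)
      sides j j≢i = noncritical _ (ts j) (λ b → proj₂ (I (step (child s o j) b))) λ b q eq′ →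
        proj₁ (conditions br p eq c j j≢i) b q eq′ ,
        ∈-++⁺ˡ (∈-concat⁺′ (into-side j j≢i (branch⇒vars b eq′)) (∈-tabulate⁺ {f = sideOf} j))

      -- One critical branch settles the agreement of the siblings, but the order condition concerns
      -- every critical leaf below child `i`.
      below : ∀ (br : Branch _ (ts i)) p → endTerm br ≡ var p → Critical ε (endSign br) p →
        ∀ {q} → q ∈ side ++ ds → Ω q p
      below br p eq c q∈ with ∈-++⁻ side q∈
      ... | inj₂ q∈ds = proj₂ (H (step (child s o i) br) p eq c) q∈ds
      ... | inj₁ q∈side with ∈-concat⁻′ _ q∈side
      ... | xs , q∈xs , xs∈ with ∈-tabulate⁻ {f = sideOf} xs∈
      ... | j , refl = let j≢i , q∈vars = from-side j q∈xs
                           b , eq′ = vars⇒branch _ (ts j) q∈vars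
                       in proj₂ (conditions br p eq c j j≢i) b _ eq′

    pia-term : ∀ {ds} s t → InternalPIA s t → CriticalBranches ds s t → PIA ds s t
    pia-term s (var p) I H with critical? s p
    ... | inj₁ c with noncritical-sign s c
    ...   | refl = pia-nc (nc-var _)
    pia-term s (var p) I H | inj₂ c with critical-sign s c
    ...   | refl = pia-crit (proj₂ (H (end _) p refl c))
    pia-term s ⊥t I H = pia-nc (noncritical s ⊥t I λ { (end _) q () })
    pia-term s ⊤t I H = pia-nc (noncritical s ⊤t I λ { (end _) q () })
    pia-term ⊕ (a ∧t b) I H = pia-meet
      (pia-term ⊕ a (λ br → proj₂ (I (step ∧l br))) (λ br p eq c → let x , y = H (step ∧l br) p eq c in proj₂ x , y))
      (pia-term ⊕ b (λ br → proj₂ (I (step ∧r br))) (λ br p eq c → let x , y = H (step ∧r br) p eq c in proj₂ x , y))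
    pia-term ⊖ (a ∧t b) I H with () ← proj₁ (I (step ∧l (branch ⊖ a)))
    pia-term ⊖ (a ∨t b) I H = pia-meet
      (pia-term ⊖ a (λ br → proj₂ (I (step ∨l br))) (λ br p eq c → let x , y = H (step ∨l br) p eq c in proj₂ x , y))
      (pia-term ⊖ b (λ br → proj₂ (I (step ∨r br))) (λ br p eq c → let x , y = H (step ∨r br) p eq c in proj₂ x , y))
    pia-term ⊕ (a ∨t b) I H with () ← proj₁ (I (step ∨l (branch ⊕ a)))
    pia-term ⊕ (gapp g ts) I H = pia-node ⊕ g ts I H λ i ds′ → pia-term _ (ts i)
    pia-term ⊖ (fapp f ts) I H = pia-node ⊖ f ts I H λ i ds′ → pia-term _ (ts i)
    pia-term ⊖ (gapp g ts) I H with empty-or-inhabited (arG g)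
    ... | inj₁ nullary = pia-nc (nc-const λ _ _ → opδ-nullary ⊕ g nullary)
    ... | inj₂ i with () ← proj₁ (I (step (gc i) (branch _ (ts i))))
    pia-term ⊕ (fapp f ts) I H with empty-or-inhabited (arF f)
    ... | inj₁ nullary = pia-nc (nc-const λ _ _ → opδ-nullary ⊖ f nullary)
    ... | inj₂ i with () ← proj₁ (I (step (fc i) (branch _ (ts i))))

    -- Reduction of a term to its forced closed bounds.

    Forced : Sign → Term → D.Carrier → Set (lsuc ℓ)
    Forced s t k = closed s k × Decomposition (λ h → leδ s k (e (⟦ t ⟧ h)))

    -- At a maximal PIA-subterm, density supplies closed elements and `decompose-≤` their
    -- conditions. Skeleton nodes preserve the resulting joins and combine the conditions of their
    -- arguments.
    forced-dense : ∀ s t → AnalyticInductiveT Ω ε s t → ∀ z → (∀ k → Forced s t k → leδ s k z) → leδ s (⟦ t ⟧δ v) z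
    forced-dense = go
      where
      internal : ∀ {s t} → kind s t ≢ skel → (∀ (b : Branch s t) → Good b) → InternalPIA s t
      internal ¬skel good (end _) = _
      internal ¬skel good (step c b) with good (step c b)
      ... | inj₁ (sk , _) = ⊥-elim (¬skel sk)
      ... | inj₂ all      = all

      at-pia : ∀ {s t} → kind s t ≢ skel → AnalyticInductiveT Ω ε s t →
        ∀ z → (∀ k → Forced s t k → leδ s k z) → leδ s (⟦ t ⟧δ v) z
      at-pia {s} {t} ¬skel (ind , good) z f = dense s λ k kc k≤ → f k (kc , decompose-≤
        (pia-term s t (internal ¬skel good) (λ b p eq c → proj₂ (ind b p eq c) , λ ())) kc k≤)

      below : ∀ {s t s′ u} → kind s t ≡ skel → Child s t s′ u → AnalyticInductiveT Ω ε s t → AnalyticInductiveT Ω ε s′ u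
      below {s} {t} sk c (ind , good) = (λ b p eq cr → good′ b , proj₂ (proj₂ (ind (step c b) p eq cr))) , good′
        where
        good′ : ∀ b → Good b
        good′ b with good (step c b)
        ... | inj₁ (_ , g) = g
        ... | inj₂ (p , _) with () ← trans (sym sk) p

      at-op : ∀ s (o : POp (flipS s)) ts →
        (∀ i z → let r = childSign (ord (flipS s) o i) s in
          (∀ k → Forced r (ts i) k → leδ r k z) → leδ r (⟦ ts i ⟧δ v) z) →
        ∀ z → (∀ k → Forced s (opT (flipS s) o ts) k → leδ s k z) → leδ s (⟦ opT (flipS s) o ts ⟧δ v) z
      at-op s o ts IH z f = subst (λ x → leδ s x z) (sym (⟦opT⟧δ (flipS s) o ts v))
        -- Forced bounds on the arguments combine to the closed element `hδ k`; it lies below the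
        -- term at `h` as soon as each argument at `h` exceeds its bound.
        (hδ-joins (λ i → Forced (sgn i) (ts i)) IH λ k k-forced → f (hδ k) (hδ-closed k ,
          weaken (every (λ i h → leδ (sgn i) (k i) (e (⟦ ts i ⟧ h))) (proj₂ ∘ k-forced)) λ y k≤ →
            subst (λ x → leδ s (hδ k) (e x)) (sym (⟦opT⟧ (flipS s) o ts y))
              (inf-lower s (e ∘ h ∘ proj₁) ((λ i → ⟦ ts i ⟧ y) , k≤))))
        where open Skeleton s o

      go : ∀ s t → AnalyticInductiveT Ω ε s t → ∀ z → (∀ k → Forced s t k → leδ s k z) → leδ s (⟦ t ⟧δ v) z
      go s (var p) = at-pia λ ()
      go s ⊥t = at-pia λ ()
      go s ⊤t = at-pia λ ()
      go ⊕ (a ∧t b) = at-pia λ ()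
      go ⊖ (a ∨t b) = at-pia λ ()
      go ⊕ (gapp g ts) = at-pia λ ()
      go ⊖ (fapp f ts) = at-pia λ ()
      go ⊕ (a ∨t b) ai z f = D.∨-least
        (go ⊕ a (below refl ∨l ai) z λ k (kc , δ) → f k (kc , weaken δ λ h p → D.trans p (e-mono ⊕ (A.x≤x∨y _ _))))
        (go ⊕ b (below refl ∨r ai) z λ k (kc , δ) → f k (kc , weaken δ λ h p → D.trans p (e-mono ⊕ (A.y≤x∨y _ _))))
      go ⊖ (a ∧t b) ai z f = D.∧-greatest
        (go ⊖ a (below refl ∧l ai) z λ k (kc , δ) → f k (kc , weaken δ λ h p → D.trans (e-mono ⊕ (A.x∧y≤x _ _)) p))
        (go ⊖ b (below refl ∧r ai) z λ k (kc , δ) → f k (kc , weaken δ λ h p → D.trans (e-mono ⊕ (A.x∧y≤y _ _)) p))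
      go ⊕ (fapp f ts) ai = at-op ⊕ f ts λ i → go _ (ts i) (below refl (fc i) ai)
      go ⊖ (gapp g ts) ai = at-op ⊖ g ts λ i → go _ (ts i) (below refl (gc i) ai)

theorem5p4 : {ℓ : Level} (Sig : Signature) (ε : PROP → Pol) (Ω : PROP → PROP → Set) →
    IsStrictPartialOrder _≡_ Ω →
    (φ ψ : Syntax.Term Sig) →
    Syntax.Transferable Sig ε φ ψ →
    Syntax.AnalyticInductive Sig Ω ε φ ψ →
    (𝔸 : NormalDLE {ℓ} Sig) →
    (D : CanonicalExtension (NormalDLE.lat 𝔸)) →
    Interp.HoldsIn𝔸 𝔸 φ ψ →
    Interp.HoldsIn𝔸δ 𝔸 D φ ψ
theorem5p4 Sig ε Ω spo φ ψ _ (aiφ , aiψ) 𝔸 D valid v =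
  forced-dense ⊕ φ aiφ _ λ k (_ , δ) →
  forced-dense ⊖ ψ aiψ _ λ k′ (_ , δ′) →
    -- The conditions from both sides are solved by a single valuation in `A`, at which validity of
    -- the inequality links `k` to `k′`.
    let h , k≤φ , ψ≤k′ = solve spo (both δ δ′ λ _ → _,_)
    in D.trans k≤φ (D.trans (e-mono ⊕ (valid h)) ψ≤k′)
  where
  open Syntax Sig using (⊕; ⊖)
  open Canonicity Sig 𝔸 D
  open Valuation ε Ω v
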